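{- Let $K$ and $L$ be finite connected simplicial complexes. If the simplicial complexes $\mathfrak{M}(K)$ and $\mathfrak{M}(L)$ (the complexes of discrete Morse functions of $K$ and of $L$) are isomorphic, then $K$ and $L$ are isomorphic simplicial complexes.
   Context: Simplicial complexes are finite abstract simplicial complexes; their simplices are nonempty, and connected complexes are nonempty. Write $\sigma\prec\tau$ if $\sigma$ is an immediate face of $\tau$, i.e. a proper maximal face ($\sigma\subset\tau$, $\dim\tau=\dim\sigma+1$). A discrete Morse function on $K$ is a map $f$ from the set of simplices of $K$ to $\mathbb{R}$ such that for every $\sigma\in K$: (1) $|\{\tau\succ\sigma : f(\tau)\le f(\sigma)\}|\le 1$ and (2) $|\{\nu\prec\sigma : f(\nu)\ge f(\sigma)\}|\le 1$. A regular pair of $f$ is a pair $(\eta,\rho)$ with $\eta\prec\rho$ and $f(\eta)\ge f(\rho)$. Every simplex belongs to at most one regular pair of $f$. Two discrete Morse functions are equivalent if they have the same regular pairs, and equivalent functions are not distinguished. Write $f\lesssim g$ if every regular pair of $f$ is a regular pair of $g$. A primitive Morse function is one with exactly one regular pair; it is identified with that pair $(\sigma,\tau)$, $\sigma\prec\tau$ (every pair $\sigma\prec\tau$ arises this way). The complex of discrete Morse functions $\mathfrak{M}(K)$ is the simplicial complex whose vertices are the primitive Morse functions on $K$ (i.e. the pairs $(\sigma,\tau)$ with $\sigma\prec\tau$ in $K$) and in which a set $\{f_0,\dots,f_r\}$ of primitive Morse functions is an $r$-simplex iff it is exactly the set of regular pairs of some discrete Morse function on $K$. Equivalently, $\mathfrak{M}(K)$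 is the complex on the edges of the Hasse diagram of the face poset of $K$ (nonempty simplices only) whose simplices are the nonempty sets of edges that form acyclic matchings: no two edges share an endpoint, and the directed graph obtained from the Hasse diagram (edges directed from larger to smaller simplices) by reversing the edges in the set has no directed cycle. -}

module Defs where

open import Level using (Level; _⊔_; 0ℓ) renaming (suc to lsuc)
open import Data.Empty using (⊥-elim)
open import Data.Fin using (Fin; zero; suc; toℕ; fromℕ<; finToFun; funToFin)
import Data.Fin.Properties as Finₚ
import Data.Fin.Induction as FinInd
open import Data.Fin.Subset
  using (Subset; Nonempty; inside; outside; ∣_∣; _∈_; _⊆_; _⊂_; _∪_; _-_; ⁅_⁆)
open import Data.Fin.Subset.Properties
  using (_∈?_; _⊂?_; nonempty?; x∈⁅x⁆; x∈⁅y⁆⇒x≡y; ∣p∣≤n; p⊂q⇒∣p∣<∣q∣;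
         p─q⊆p; p─⊥≡p; x∈p∧x≢y⇒x∈p-y; x∈p⇒p-x⊂p)
import Data.Integer as ℤ
import Data.Integer.Properties as ℤₚ
open import Data.List using (List; []; _∷_; _++_; map; filter; length; lookup; cartesianProduct)
open import Data.List.Membership.Propositional using () renaming (_∈_ to _∈ˡ_)
open import Data.List.Membership.Propositional.Properties
  using (∈-++⁺ˡ; ∈-++⁺ʳ; ∈-map⁺; ∈-map⁻; ∈-filter⁺; ∈-filter⁻; ∈-cartesianProduct⁺; ∈-lookup)
open import Data.List.Relation.Unary.All as All using (All; []; _∷_)
open import Data.List.Relation.Unary.Any as Any using (here; there)
open import Data.List.Relation.Unary.Any.Properties using (lookup-index)
open import Data.List.Relation.Unary.Unique.Propositional using (Unique; []; _∷_)
import Data.List.Relation.Unary.Unique.Propositional.Properties as Uniqueₚ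
open import Data.Nat as ℕ using (ℕ; zero; suc; s≤s; z≤n; _∸_; _^_)
import Data.Nat.Properties as ℕₚ
open import Data.Nat.Induction using (<-wellFounded)
import Data.Nat.Coprimality as Coprimality
open import Data.Product using (Σ; ∃; ∃-syntax; _×_; _,_; proj₁; proj₂)
open import Data.Rational as ℚ using (ℚ; mkℚ; 1ℚ; *≤*; *<*)
import Data.Rational.Properties as ℚₚ
open import Data.Sum using (_⊎_; inj₁; inj₂)
open import Data.Vec using ([]; _∷_; tabulate; here; there)
import Data.Vec as Vec
import Data.Vec.Properties as Vecₚ
import Data.Bool.Properties as Boolₚ
open import Function using (_∘_; flip)
open import Function.Bundles using (_↔_; _⇔_; mk⇔; module Inverse; module Equivalence)
open import Induction.WellFounded using (WellFounded; Acc; acc)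
open import Relation.Binary.Construct.Closure.ReflexiveTransitive using (Star)
open import Relation.Binary.PropositionalEquality
  using (_≡_; _≢_; refl; sym; trans; cong; cong₂; subst; subst₂; isEquivalence)
import Relation.Binary as B
open import Relation.Nullary using (¬_; Dec; yes; no; contradiction)
open import Relation.Nullary.Decidable
  using (recompute; map′; ¬?; _×-dec_; _⊎-dec_; _→-dec_; isYes)
open import Relation.Unary using (Pred; Decidable)

private variable
  n m : ℕ
  k ℓ : Level

-- Two-sided Dedekind cuts.  Discrete Morse functions use only the order
-- of ℝ.
record ℝ : Set₁ where
  field
    Lower Upper : ℚ → Set
    lower-inhabited : ∃ Lower
    upper-inhabited : ∃ Upper
    lower-rounded   : ∀ q → Lower q ⇔ (∃[ r ] q ℚ.< r × Lower r)
    upper-rounded   : ∀ q → Upper q ⇔ (∃[ p ] p ℚ.< q × Upper p)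
    disjoint        : ∀ q → ¬ (Lower q × Upper q)
    located         : ∀ p q → p ℚ.< q → Lower p ⊎ Upper q

infix 4 _≤_ _≰_

_≤_ : ℝ → ℝ → Set
x ≤ y = ∀ q → ℝ.Lower x q → ℝ.Lower y q

_≰_ : ℝ → ℝ → Set
x ≰ y = ¬ (x ≤ y)

-- Vertices are the elements of Fin #vertices.  #vertices = 0 gives the
-- empty complex.
record SimplicialComplex ℓ : Set (lsuc ℓ) where
  field
    #vertices   : ℕ
    Face        : Pred (Subset #vertices) ℓ
    face?       : Decidable Face
    nonempty    : ∀ {σ} → Face σ → Nonempty σ
    down-closed : ∀ {σ τ} → Face τ → σ ⊆ τ → Nonempty σ → Face σ
    vertex      : ∀ v → Face ⁅ v ⁆

open SimplicialComplex using (#vertices; Face)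

-- The image under φ, computed as the preimage under its inverse.
image : Fin n ↔ Fin m → Subset n → Subset m
image φ σ = tabulate (λ j → Vec.lookup σ (Inverse.from φ j))

infix 4 _≅_

record _≅_ (K : SimplicialComplex k) (L : SimplicialComplex ℓ) : Set (k ⊔ ℓ) where
  field
    vertices↔ : Fin (#vertices K) ↔ Fin (#vertices L)
    face⇔     : ∀ σ → Face K σ ⇔ Face L (image vertices↔ σ)

Adjacent : (K : SimplicialComplex k) → Fin (#vertices K) → Fin (#vertices K) → Set k
Adjacent K u v = Face K (⁅ u ⁆ ∪ ⁅ v ⁆)

Connected : SimplicialComplex k → Set k
Connected K = Fin (#vertices K) × (∀ u v → Star (Adjacent K) u v)

-- The face proof is irrelevant, so that simplices with the same vertices
-- are equal.
record Simplex (K : SimplicialComplex k) : Set k where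
  constructor simplex
  field
    vertices : Subset (#vertices K)
    .isFace  : Face K vertices

open Simplex using (vertices)

module _ {K : SimplicialComplex k} where

  dim : Simplex K → ℕ
  dim σ = ∣ vertices σ ∣ ∸ 1

  infix 4 _≺_

  record _≺_ (σ τ : Simplex K) : Set where
    constructor _,_
    field
      proper : vertices σ ⊂ vertices τ
      dim-1  : dim τ ≡ suc (dim σ)

  -- "At most one" is expressed as: any two are equal.
  record IsDiscreteMorse (f : Simplex K → ℝ) : Set k where
    field
      coface-unique : ∀ {σ τ τ′} → σ ≺ τ  → f τ  ≤ f σ →
                                   σ ≺ τ′ → f τ′ ≤ f σ → τ ≡ τ′
      face-unique   : ∀ {σ ν ν′} → ν  ≺ σ → f σ ≤ f ν  →
                                   ν′ ≺ σ → f σ ≤ f ν′ → ν ≡ ν′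

  RegularPair : (Simplex K → ℝ) → Simplex K × Simplex K → Set
  RegularPair f (η , ρ) = η ≺ ρ × f ρ ≤ f η

  _≺?_ : B.Decidable _≺_
  σ ≺? τ = map′ (λ (p , d) → p , d) (λ (p , d) → p , d)
    ((vertices σ ⊂? vertices τ) ×-dec (dim τ ℕ.≟ suc (dim σ)))

  _≟ₛ_ : B.DecidableEquality (Simplex K)
  simplex s _ ≟ₛ simplex t _ with Vecₚ.≡-dec Boolₚ._≟_ s t
  ... | yes refl = yes refl
  ... | no  s≢t  = no (s≢t ∘ cong vertices)

subsets : ∀ n → List (Subset n)
subsets zero    = [] ∷ []
subsets (suc n) = map (inside ∷_) (subsets n) ++ map (outside ∷_) (subsets n)

module _ (K : SimplicialComplex k) where

  open SimplicialComplex K using (face?)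

  simplicesAmong : List (Subset (#vertices K)) → List (Simplex K)
  simplicesAmong []       = []
  simplicesAmong (s ∷ ss) with face? s
  ... | yes p = simplex s p ∷ simplicesAmong ss
  ... | no  _ = simplicesAmong ss

  simplices : List (Simplex K)
  simplices = simplicesAmong (subsets (#vertices K))

  ≺-pairs : List (Simplex K × Simplex K)
  ≺-pairs = filter (λ (σ , τ) → σ ≺? τ) (cartesianProduct simplices simplices)

  -- A primitive Morse function is identified with its regular pair.
  primitivePair : Fin (length ≺-pairs) → Simplex K × Simplex K
  primitivePair = lookup ≺-pairs

  MorseFace : Subset (length ≺-pairs) → Set (lsuc 0ℓ ⊔ k)
  MorseFace s = Nonempty s ×
    Σ (Simplex K → ℝ) λ f → IsDiscreteMorse f × (∀ i → i ∈ s ⇔ RegularPair f (primitivePair i))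

-- From here to 𝔐: MorseFace K is decidable, holds of singletons and is
-- closed under nonempty subsets, so that 𝔐 K is a finite complex.

≤-refl : ∀ x → x ≤ x
≤-refl x q xq = xq

≤-trans : ∀ {x y z} → x ≤ y → y ≤ z → x ≤ z
≤-trans x≤y y≤z q = y≤z q ∘ x≤y q

lower-closed : ∀ x {p q} → p ℚ.< q → ℝ.Lower x q → ℝ.Lower x p
lower-closed x p<q xq = Equivalence.from (ℝ.lower-rounded x _) (_ , p<q , xq)

lower<upper : ∀ x {p q} → ℝ.Lower x p → ℝ.Upper x q → p ℚ.< q
lower<upper x {p} {q} xp xq with ℚₚ.<-cmp p q
... | B.tri< p<q _ _  = p<q
... | B.tri≈ _ refl _ = contradiction (xp , xq) (ℝ.disjoint x p)
... | B.tri> _ _ q<p  = contradiction (lower-closed x q<p xp , xq) (ℝ.disjoint x q)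

≰⇒≥ : ∀ x y → x ≰ y → y ≤ x
≰⇒≥ x y x≰y q yq with Equivalence.to (ℝ.lower-rounded y q) yq
... | r , q<r , yr with ℝ.located x q r q<r
...   | inj₁ xq = xq
...   | inj₂ xr = ⊥-elim (x≰y λ p xp → lower-closed y (lower<upper x xp xr) yr)

fromℚ : ℚ → ℝ
fromℚ x = record
  { Lower           = ℚ._< x
  ; Upper           = x ℚ.<_
  ; lower-inhabited = x ℚ.- 1ℚ , subst (x ℚ.- 1ℚ ℚ.<_) (ℚₚ.+-identityʳ x) (ℚₚ.+-monoʳ-< x -1<0)
  ; upper-inhabited = x ℚ.+ 1ℚ , subst (ℚ._< x ℚ.+ 1ℚ) (ℚₚ.+-identityʳ x) (ℚₚ.+-monoʳ-< x 0<1)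
  ; lower-rounded   = λ q → mk⇔ (λ q<x → let r , q<r , r<x = ℚₚ.<-dense q<x in r , q<r , r<x)
                                (λ (r , q<r , r<x) → ℚₚ.<-trans q<r r<x)
  ; upper-rounded   = λ q → mk⇔ (λ x<q → let p , x<p , p<q = ℚₚ.<-dense x<q in p , p<q , x<p)
                                (λ (p , p<q , x<p) → ℚₚ.<-trans x<p p<q)
  ; disjoint        = λ q (q<x , x<q) → ℚₚ.<-irrefl refl (ℚₚ.<-trans q<x x<q)
  ; located         = loc
  }
  where
  0<1 : ℚ.0ℚ ℚ.< 1ℚ
  0<1 = *<* (ℤ.+<+ (s≤s z≤n))
  -1<0 : ℚ.- 1ℚ ℚ.< ℚ.0ℚ
  -1<0 = *<* ℤ.-<+
  loc : ∀ p q → p ℚ.< q → p ℚ.< x ⊎ x ℚ.< q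
  loc p q p<q with p ℚₚ.<? x
  ... | yes p<x = inj₁ p<x
  ... | no  p≮x = inj₂ (ℚₚ.≤-<-trans (ℚₚ.≮⇒≥ p≮x) p<q)

fromℕ : ℕ → ℝ
fromℕ a = fromℚ (mkℚ (ℤ.+ a) 0 (Coprimality.sym (Coprimality.1-coprimeTo a)))

fromℕ-mono-< : ∀ {a b} → a ℕ.< b → fromℕ b ≰ fromℕ a
fromℕ-mono-< {a} {b} a<b b≤a = ℚₚ.<-irrefl refl (b≤a _ (*<* (ℤₚ.*-monoʳ-<-pos (ℤ.+ 1) (ℤ.+<+ a<b))))

fromℕ-mono-≤ : ∀ {a b} → a ℕ.≤ b → fromℕ a ≤ fromℕ b
fromℕ-mono-≤ a≤b q q<a = ℚₚ.<-≤-trans q<a (*≤* (ℤₚ.*-monoʳ-≤-nonNeg (ℤ.+ 1) (ℤ.+≤+ a≤b)))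

∣p∣≡1+∣p-x∣ : ∀ {p : Subset n} {x} → x ∈ p → ∣ p ∣ ≡ suc ∣ p - x ∣
∣p∣≡1+∣p-x∣ {p = inside ∷ p} here            = cong (suc ∘ ∣_∣) (sym (p─⊥≡p p))
∣p∣≡1+∣p-x∣ {p = inside ∷ p} (there x∈p)  = cong suc (∣p∣≡1+∣p-x∣ x∈p)
∣p∣≡1+∣p-x∣ {p = outside ∷ p} (there x∈p) = ∣p∣≡1+∣p-x∣ x∈p

-- A code for a function Fin m → Fin (suc m) that decreases along R.
Ranking : ∀ {m} → B.Rel (Fin m) ℓ → Set ℓ
Ranking {m = m} R = Σ (Fin (suc m ^ m)) λ c → ∀ a b → R a b → toℕ (finToFun c b) ℕ.< toℕ (finToFun c a)

module _ {m} {R : B.Rel (Fin m) ℓ} (R? : B.Decidable R) where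

  ranking? : Dec (Ranking R)
  ranking? = Finₚ.any? λ c → Finₚ.all? λ a → Finₚ.all? λ b →
    R? a b →-dec (toℕ (finToFun c b) ℕₚ.<? toℕ (finToFun c a))

  private
    sum : ∀ {n} → (Fin n → ℕ) → ℕ
    sum {zero}  g = 0
    sum {suc n} g = g zero ℕ.+ sum (g ∘ suc)

    sum-cong : ∀ {n} {g h : Fin n → ℕ} → (∀ i → g i ≡ h i) → sum g ≡ sum h
    sum-cong {zero}  eq = refl
    sum-cong {suc n} eq = cong₂ ℕ._+_ (eq zero) (sum-cong (eq ∘ suc))

    term≤sum : ∀ {n} (g : Fin n → ℕ) i → g i ℕ.≤ sum g
    term≤sum g zero    = ℕₚ.m≤m+n _ _
    term≤sum g (suc i) = ℕₚ.≤-trans (term≤sum (g ∘ suc) i) (ℕₚ.m≤n+m _ _)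

    rank : ∀ a → Acc (flip R) a → ℕ
    term : ∀ {a b} → Dec (R a b) → (∀ {b} → R a b → Acc (flip R) b) → ℕ

    rank a (acc rs) = sum λ b → term (R? a b) rs
    term (yes r) rs = suc (rank _ (rs r))
    term (no _)  rs = 0

    rank-irr : ∀ a (p q : Acc (flip R) a) → rank a p ≡ rank a q
    rank-irr a (acc rs) (acc rs′) = sum-cong λ b → go b (R? a b)
      where
      go : ∀ b (d : Dec (R a b)) → term d rs ≡ term d rs′
      go b (yes r) = cong suc (rank-irr b (rs r) (rs′ r))
      go b (no _)  = refl

    rank-< : ∀ {a b} (p : Acc (flip R) a) (q : Acc (flip R) b) → R a b → rank b q ℕ.< rank a p
    rank-< {a} {b} (acc rs) q r = ℕₚ.≤-trans (go (R? a b)) (term≤sum (λ b → term (R? a b) rs) b)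
      where
      go : (d : Dec (R a b)) → suc (rank b q) ℕ.≤ term d rs
      go (yes r′) = ℕₚ.≤-reflexive (cong suc (rank-irr b q (rs r′)))
      go (no ¬r)  = contradiction r ¬r

  wellFounded⇒ranking : WellFounded (flip R) → Ranking R
  wellFounded⇒ranking wf = funToFin pos , λ a b r →
    subst₂ ℕ._<_ (sym (toℕ-pos b)) (sym (toℕ-pos a)) (p⊂q⇒∣p∣<∣q∣ (below-⊂ (rank-< (wf a) (wf b) r)))
    where
    ρ : Fin m → ℕ
    ρ a = rank a (wf a)

    below : Fin m → Subset m
    below a = tabulate λ b → isYes (ρ b ℕₚ.<? ρ a)

    ∈-below⁺ : ∀ {a b} → ρ b ℕ.< ρ a → b ∈ below a
    ∈-below⁺ {a} {b} lt = Vecₚ.lookup⇒[]= b (below a)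
      (trans (Vecₚ.lookup∘tabulate _ b) (go (ρ b ℕₚ.<? ρ a)))
      where
      go : (d : Dec (ρ b ℕ.< ρ a)) → isYes d ≡ inside
      go (yes _)  = refl
      go (no ¬lt) = contradiction lt ¬lt

    ∈-below⁻ : ∀ {a b} → b ∈ below a → ρ b ℕ.< ρ a
    ∈-below⁻ {a} {b} b∈ = go (ρ b ℕₚ.<? ρ a)
      (trans (sym (Vecₚ.lookup∘tabulate _ b)) (Vecₚ.[]=⇒lookup b∈))
      where
      go : (d : Dec (ρ b ℕ.< ρ a)) → isYes d ≡ inside → ρ b ℕ.< ρ a
      go (yes lt) _ = lt

    below-⊂ : ∀ {a b} → ρ b ℕ.< ρ a → below b ⊂ below a
    below-⊂ {a} {b} lt =
      (λ x∈ → ∈-below⁺ (ℕₚ.<-trans (∈-below⁻ x∈) lt)) ,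
      b , ∈-below⁺ lt , (ℕₚ.<-irrefl refl ∘ ∈-below⁻)

    pos : Fin m → Fin (suc m)
    pos a = fromℕ< (s≤s (∣p∣≤n (below a)))

    toℕ-pos : ∀ a → toℕ (finToFun (funToFin pos) a) ≡ ∣ below a ∣
    toℕ-pos a = trans (cong toℕ (Finₚ.finToFun-funToFin pos a)) (Finₚ.toℕ-fromℕ< _)

lookup-injective : ∀ {A : Set ℓ} {xs : List A} → Unique xs →
                   ∀ i j → lookup xs i ≡ lookup xs j → i ≡ j
lookup-injective (_ ∷ _)   zero    zero    _  = refl
lookup-injective (x∉ ∷ _)  zero    (suc j) eq = contradiction eq (All.lookup x∉ (∈-lookup j))
lookup-injective (x∉ ∷ _)  (suc i) zero    eq = contradiction (sym eq) (All.lookup x∉ (∈-lookup i))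
lookup-injective (_ ∷ xs!) (suc i) (suc j) eq = cong suc (lookup-injective xs! i j eq)

∈-subsets : (s : Subset n) → s ∈ˡ subsets n
∈-subsets []            = here refl
∈-subsets (inside ∷ s)  = ∈-++⁺ˡ (∈-map⁺ _ (∈-subsets s))
∈-subsets (outside ∷ s) = ∈-++⁺ʳ _ (∈-map⁺ _ (∈-subsets s))

subsets-unique : ∀ n → Unique (subsets n)
subsets-unique zero    = [] ∷ []
subsets-unique (suc n) = Uniqueₚ.++⁺
  (Uniqueₚ.map⁺ Vecₚ.∷-injectiveʳ (subsets-unique n))
  (Uniqueₚ.map⁺ Vecₚ.∷-injectiveʳ (subsets-unique n))
  λ (x∈ , y∈) → clash (∈-map⁻ _ x∈) (∈-map⁻ _ y∈)
  where
  clash : ∀ {x : Subset (suc n)} → (∃ λ y → y ∈ˡ subsets n × x ≡ inside ∷ y) →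
          ¬ (∃ λ y → y ∈ˡ subsets n × x ≡ outside ∷ y)
  clash (_ , _ , refl) (_ , _ , ())

module _ (K : SimplicialComplex k) where

  open SimplicialComplex K using (face?; down-closed)

  face : ∀ (σ : Simplex K) → Face K (vertices σ)
  face (simplex s p) = recompute (face? s) p

  ∈-simplicesAmong : ∀ {ss} (σ : Simplex K) → vertices σ ∈ˡ ss → σ ∈ˡ simplicesAmong K ss
  ∈-simplicesAmong {s ∷ ss} σ σ∈ with face? s | σ∈
  ... | yes _ | here refl = here refl
  ... | yes _ | there σ∈′ = there (∈-simplicesAmong σ σ∈′)
  ... | no ¬p | here refl = contradiction (face σ) ¬p
  ... | no _  | there σ∈′ = ∈-simplicesAmong σ σ∈′

  vertices-∈ : ∀ {ss} {σ : Simplex K} → σ ∈ˡ simplicesAmong K ss → vertices σ ∈ˡ ss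
  vertices-∈ {s ∷ ss} σ∈ with face? s | σ∈
  ... | yes _ | here refl = here refl
  ... | yes _ | there σ∈′ = there (vertices-∈ σ∈′)
  ... | no _  | σ∈′       = there (vertices-∈ σ∈′)

  simplicesAmong-unique : ∀ {ss} → Unique ss → Unique (simplicesAmong K ss)
  simplicesAmong-unique []                   = []
  simplicesAmong-unique {s ∷ ss} (s∉ ∷ ss!) with face? s
  ... | yes p = All.tabulate (λ τ∈ s≡τ → All.lookup s∉ (vertices-∈ τ∈) (cong vertices s≡τ))
              ∷ simplicesAmong-unique ss!
  ... | no  _ = simplicesAmong-unique ss!

  ∈-simplices : ∀ σ → σ ∈ˡ simplices K
  ∈-simplices σ = ∈-simplicesAmong σ (∈-subsets (vertices σ))

  primitivePair-injective : ∀ {i j} → primitivePair K i ≡ primitivePair K j → i ≡ j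
  primitivePair-injective {i} {j} = lookup-injective
    (Uniqueₚ.filter⁺ (λ (σ , τ) → σ ≺? τ) (Uniqueₚ.cartesianProduct⁺ simplices! simplices!)) i j
    where
    simplices! = simplicesAmong-unique (subsets-unique (#vertices K))

  primitivePair-surjective : ∀ {σ τ} → σ ≺ τ → ∃[ i ] primitivePair K i ≡ (σ , τ)
  primitivePair-surjective {σ} {τ} σ≺τ = Any.index στ∈ , sym (lookup-index στ∈)
    where
    στ∈ : (σ , τ) ∈ˡ ≺-pairs K
    στ∈ = ∈-filter⁺ (λ (σ , τ) → σ ≺? τ) (∈-cartesianProduct⁺ (∈-simplices σ) (∈-simplices τ)) σ≺τ

  lower upper : Fin (length (≺-pairs K)) → Simplex K
  lower i = proj₁ (primitivePair K i)
  upper i = proj₂ (primitivePair K i)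

  primitivePair-≺ : ∀ i → lower i ≺ upper i
  primitivePair-≺ i = proj₂ (∈-filter⁻ (λ (σ , τ) → σ ≺? τ)
    {xs = cartesianProduct (simplices K) (simplices K)} (∈-lookup i))

  PrimitiveSet : Set
  PrimitiveSet = Subset (length (≺-pairs K))

  Meet : B.Rel (Fin (length (≺-pairs K))) k
  Meet i j = lower i ≡ lower j ⊎ upper i ≡ upper j ⊎ upper i ≡ lower j

  Matching : PrimitiveSet → Set k
  Matching s = ∀ i j → i ∈ s → j ∈ s → Meet i j → i ≡ j

  -- One step of a V-path: up along a pair of s, down to another face.
  VStep : PrimitiveSet → B.Rel (Simplex K) k
  VStep s η ν = ∃[ i ] i ∈ s × lower i ≡ η × ν ≺ upper i × ν ≢ η

  -- The absence of closed V-paths, witnessed by a bounded potential.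
  record Acyclic (s : PrimitiveSet) : Set k where
    field
      potential  : Simplex K → ℕ
      bound      : ℕ
      bounded    : ∀ σ → potential σ ℕ.< bound
      decreasing : ∀ {η ν} → VStep s η ν → potential ν ℕ.< potential η

  matching? : Decidable Matching
  matching? s = Finₚ.all? λ i → Finₚ.all? λ j → (i ∈? s) →-dec ((j ∈? s) →-dec
    (((lower i ≟ₛ lower j) ⊎-dec ((upper i ≟ₛ upper j) ⊎-dec (upper i ≟ₛ lower j)))
      →-dec (i Finₚ.≟ j)))

  vStep? : ∀ s → B.Decidable (VStep s)
  vStep? s η ν = Finₚ.any? λ i →
    (i ∈? s) ×-dec ((lower i ≟ₛ η) ×-dec ((ν ≺? upper i) ×-dec ¬? (ν ≟ₛ η)))

  private
    #simplices : ℕ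
    #simplices = length (simplices K)

    nth : Fin #simplices → Simplex K
    nth = lookup (simplices K)

    index : Simplex K → Fin #simplices
    index σ = Any.index (∈-simplices σ)

    nth-index : ∀ σ → nth (index σ) ≡ σ
    nth-index σ = sym (lookup-index (∈-simplices σ))

    VStepₙ : PrimitiveSet → B.Rel (Fin #simplices) k
    VStepₙ s a b = VStep s (nth a) (nth b)

    ranking⇒acyclic : ∀ {s} → Ranking (VStepₙ s) → Acyclic s
    ranking⇒acyclic {s} (c , decr) = record
      { potential  = λ σ → toℕ (finToFun c (index σ))
      ; bound      = suc #simplices
      ; bounded    = λ σ → Finₚ.toℕ<n (finToFun c (index σ))
      ; decreasing = λ {η} {ν} st → decr (index η) (index ν)
          (subst₂ (VStep s) (sym (nth-index η)) (sym (nth-index ν)) st)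
      }

    acyclic⇒wf : ∀ {s} → Acyclic s → WellFounded (flip (VStepₙ s))
    acyclic⇒wf {s} A a = go a (<-wellFounded _)
      where
      open Acyclic A
      go : ∀ a → Acc ℕ._<_ (potential (nth a)) → Acc (flip (VStepₙ s)) a
      go a (acc rs) = acc λ {b} st → go b (rs (decreasing st))

  acyclic? : Decidable Acyclic
  acyclic? s = map′ ranking⇒acyclic (wellFounded⇒ranking R? ∘ acyclic⇒wf) (ranking? R?)
    where
    R? : B.Decidable (VStepₙ s)
    R? a b = vStep? s (nth a) (nth b)

  private
    MorseFrom : PrimitiveSet → (Simplex K → ℝ) → Set k
    MorseFrom s f = IsDiscreteMorse f × (∀ i → i ∈ s ⇔ RegularPair f (primitivePair K i))

  -- If σ ≺ τ ≺ ω then some τ′ ≢ τ lies between σ and ω.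
  diamond : ∀ {σ τ ω : Simplex K} → σ ≺ τ → τ ≺ ω →
            Σ (Simplex K) λ τ′ → σ ≺ τ′ × τ′ ≺ ω × τ ≢ τ′
  diamond {σ} {τ} {ω} ((σ⊆τ , x , x∈τ , x∉σ) , dτ) ((τ⊆ω , y , y∈ω , y∉τ) , dω) =
    τ′ , ((σ⊆τ′ , y , y∈τ′ , y∉τ ∘ σ⊆τ) , trans dτ′ dτ) ,
    (x∈p⇒p-x⊂p (τ⊆ω x∈τ) , trans dω (cong suc (sym dτ′))) ,
    λ τ≡τ′ → y∉τ (subst (λ ρ → y ∈ vertices ρ) (sym τ≡τ′) y∈τ′)
    where
    y∈τ′ : y ∈ vertices ω - x
    y∈τ′ = x∈p∧x≢y⇒x∈p-y y∈ω λ y≡x → y∉τ (subst (_∈ vertices τ) (sym y≡x) x∈τ)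
    σ⊆τ′ : vertices σ ⊆ vertices ω - x
    σ⊆τ′ v∈σ = x∈p∧x≢y⇒x∈p-y (τ⊆ω (σ⊆τ v∈σ)) λ v≡x → x∉σ (subst (_∈ vertices σ) v≡x v∈σ)
    τ′ : Simplex K
    τ′ = simplex (vertices ω - x)
      (down-closed (face ω) (p─q⊆p (vertices ω) ⁅ x ⁆) (y , y∈τ′))
    dτ′ : dim τ′ ≡ dim τ
    dτ′ = ℕₚ.suc-injective (trans (sym (trans (cong (_∸ 1) (∣p∣≡1+∣p-x∣ (τ⊆ω x∈τ))) (pos y∈τ′))) dω)
      where
      pos : ∀ {n} {p : Subset n} {v} → v ∈ p → ∣ p ∣ ≡ suc (∣ p ∣ ∸ 1)
      pos here = refl
      pos {p = inside ∷ p}  (there v∈p) = refl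
      pos {p = outside ∷ p} (there v∈p) = pos v∈p

  module FromMorse {s} {f : Simplex K → ℝ} (M : MorseFrom s f) where
    open IsDiscreteMorse (proj₁ M)

    regular : ∀ {i} → i ∈ s → f (upper i) ≤ f (lower i)
    regular {i} i∈s = proj₂ (Equivalence.to (proj₂ M i) i∈s)

    noChain : ∀ {σ τ ω} → σ ≺ τ → τ ≺ ω → f τ ≤ f σ → f ω ≰ f τ
    noChain {σ} {τ} {ω} σ≺τ τ≺ω τ≤σ ω≤τ with diamond {σ} {τ} {ω} σ≺τ τ≺ω
    ... | τ′ , σ≺τ′ , τ′≺ω , τ≢τ′ =
      τ≢τ′ (coface-unique σ≺τ τ≤σ σ≺τ′
        (≤-trans {f τ′} {f ω} {f σ}
          (≰⇒≥ (f ω) (f τ′) λ ω≤τ′ → τ≢τ′ (face-unique τ≺ω ω≤τ τ′≺ω ω≤τ′))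
          (≤-trans {f ω} {f τ} {f σ} ω≤τ τ≤σ)))

    matching : Matching s
    matching i j i∈s j∈s m = primitivePair-injective (go m)
      where
      go : Meet i j → primitivePair K i ≡ primitivePair K j
      go (inj₁ l≡l) = cong₂ _,_ l≡l (coface-unique (primitivePair-≺ i) (regular i∈s)
        (subst (_≺ upper j) (sym l≡l) (primitivePair-≺ j))
        (subst (λ σ → f (upper j) ≤ f σ) (sym l≡l) (regular j∈s)))
      go (inj₂ (inj₁ u≡u)) = cong₂ _,_ (face-unique (primitivePair-≺ i) (regular i∈s)
        (subst (lower j ≺_) (sym u≡u) (primitivePair-≺ j))
        (subst (λ σ → f σ ≤ f (lower j)) (sym u≡u) (regular j∈s))) u≡u
      go (inj₂ (inj₂ u≡l)) = contradiction
        (subst (λ σ → f (upper j) ≤ f σ) (sym u≡l) (regular j∈s))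
        (noChain (primitivePair-≺ i) (subst (_≺ upper j) (sym u≡l) (primitivePair-≺ j)) (regular i∈s))

    descends : ∀ {η ν} → VStep s η ν → f η ≰ f ν
    descends {_} {ν} (i , i∈s , refl , ν≺ρ , ν≢η) η≤ν = ν≢η
      (face-unique ν≺ρ (≤-trans {f (upper i)} {f (lower i)} {f ν} (regular i∈s) η≤ν)
        (primitivePair-≺ i) (regular i∈s))

    acyclic : Acyclic s
    acyclic = ranking⇒acyclic (wellFounded⇒ranking (λ a b → vStep? s (nth a) (nth b)) wf)
      where
      ⊐-spo : B.IsStrictPartialOrder _≡_ (λ a b → f (nth b) ≰ f (nth a))
      ⊐-spo = record
        { isEquivalence = isEquivalence
        ; irrefl        = λ { {a} refl a≰a → a≰a (≤-refl (f (nth a))) }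
        ; trans         = λ {a} {b} {c} b≰a c≰b c≤a → c≰b
            (≤-trans {f (nth c)} {f (nth a)} {f (nth b)} c≤a (≰⇒≥ (f (nth b)) (f (nth a)) b≰a))
        ; <-resp-≈      = (λ { refl p → p }) , (λ { refl p → p })
        }

      wf : WellFounded (flip (VStepₙ s))
      wf a = go a (FinInd.spo-wellFounded ⊐-spo a)
        where
        go : ∀ a → Acc (λ a b → f (nth b) ≰ f (nth a)) a → Acc (flip (VStepₙ s)) a
        go a (acc rs) = acc λ {b} st → go b (rs (descends st))

  module ToMorse {s} (mat : Matching s) (A : Acyclic s) where
    open Acyclic A renaming (potential to r)

    IsUpper : Simplex K → Set k
    IsUpper σ = ∃[ i ] i ∈ s × upper i ≡ σ

    isUpper? : Decidable IsUpper
    isUpper? σ = Finₚ.any? λ i → (i ∈? s) ×-dec (upper i ≟ₛ σ)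

    base′ : ∀ {σ} → Dec (IsUpper σ) → Simplex K
    base′ {σ} (yes (i , _)) = lower i
    base′ {σ} (no _)        = σ

    level : Simplex K → ℕ
    level σ = bound ℕ.* dim σ ℕ.+ r σ

    value′ : ∀ {σ} → Dec (IsUpper σ) → ℕ
    value′ d = level (base′ d)

    value : Simplex K → ℕ
    value σ = value′ (isUpper? σ)

    f : Simplex K → ℝ
    f σ = fromℕ (value σ)

    level-< : ∀ (σ τ : Simplex K) → dim σ ℕ.< dim τ → level σ ℕ.< bound ℕ.* dim τ
    level-< σ τ lt = begin-strict
      bound ℕ.* dim σ ℕ.+ r σ     <⟨ ℕₚ.+-monoʳ-< (bound ℕ.* dim σ) (bounded σ) ⟩
      bound ℕ.* dim σ ℕ.+ bound   ≡⟨ ℕₚ.+-comm (bound ℕ.* dim σ) bound ⟩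
      bound ℕ.+ bound ℕ.* dim σ   ≡⟨ ℕₚ.*-suc bound (dim σ) ⟨
      bound ℕ.* suc (dim σ)       ≤⟨ ℕₚ.*-monoʳ-≤ bound lt ⟩
      bound ℕ.* dim τ             ∎
      where open ℕₚ.≤-Reasoning

    dim-< : ∀ {σ τ : Simplex K} → σ ≺ τ → dim σ ℕ.< dim τ
    dim-< (_ , eq) = ℕₚ.≤-reflexive (sym eq)

    base-dim : ∀ {σ} (d : Dec (IsUpper σ)) → dim (base′ d) ℕ.≤ dim σ
    base-dim (yes (i , _ , refl)) = ℕₚ.<⇒≤ (dim-< (primitivePair-≺ i))
    base-dim (no _)               = ℕₚ.≤-refl

    value-upper : ∀ {i} (d : Dec (IsUpper (upper i))) → i ∈ s → value′ d ≡ level (lower i)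
    value-upper {i} (yes (j , j∈s , u≡u)) i∈s =
      cong (level ∘ lower) (mat j i j∈s i∈s (inj₂ (inj₁ u≡u)))
    value-upper {i} (no ¬u) i∈s = contradiction (i , i∈s , refl) ¬u

    value-lower : ∀ {i} (d : Dec (IsUpper (lower i))) → i ∈ s → value′ d ≡ level (lower i)
    value-lower {i} (yes (j , j∈s , u≡l)) i∈s with mat j i j∈s i∈s (inj₂ (inj₂ u≡l))
    ... | refl = refl
    value-lower {i} (no _) i∈s = refl

    value-≺ : ∀ {ν σ} (d : Dec (IsUpper ν)) (e : Dec (IsUpper σ)) → ν ≺ σ →
              ¬ (∃[ i ] i ∈ s × lower i ≡ ν × upper i ≡ σ) → value′ d ℕ.< value′ e
    value-≺ {_} {σ} d (no _) ν≺σ _ = ℕₚ.<-≤-trans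
      (level-< (base′ d) σ (ℕₚ.≤-<-trans (base-dim d) (dim-< ν≺σ))) (ℕₚ.m≤m+n _ _)
    value-≺ {ν} d (yes (i , i∈s , refl)) ν≺σ unmatched = go d
      where
      dim≡ : dim ν ≡ dim (lower i)
      dim≡ = ℕₚ.suc-injective (trans (sym (_≺_.dim-1 ν≺σ)) (_≺_.dim-1 (primitivePair-≺ i)))
      go : (d : Dec (IsUpper ν)) → value′ d ℕ.< level (lower i)
      go (yes (j , _ , refl)) = ℕₚ.<-≤-trans
        (level-< (lower j) (lower i) (subst (dim (lower j) ℕ.<_) dim≡ (dim-< (primitivePair-≺ j)))) (ℕₚ.m≤m+n _ _)
      go (no _) = subst (λ d → bound ℕ.* d ℕ.+ r ν ℕ.< level (lower i)) (sym dim≡)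
        (ℕₚ.+-monoʳ-< (bound ℕ.* dim (lower i))
          (decreasing (i , i∈s , refl , ν≺σ , λ ν≡η → unmatched (i , i∈s , sym ν≡η , refl))))

    matched? : ∀ ν σ → Dec (∃[ i ] i ∈ s × lower i ≡ ν × upper i ≡ σ)
    matched? ν σ = Finₚ.any? λ i → (i ∈? s) ×-dec ((lower i ≟ₛ ν) ×-dec (upper i ≟ₛ σ))

    regular⇒matched : ∀ {ν σ} → ν ≺ σ → f σ ≤ f ν → ∃[ i ] i ∈ s × lower i ≡ ν × upper i ≡ σ
    regular⇒matched {ν} {σ} ν≺σ σ≤ν with matched? ν σ
    ... | yes p = p
    ... | no ¬p = contradiction σ≤ν (fromℕ-mono-< (value-≺ (isUpper? ν) (isUpper? σ) ν≺σ ¬p))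

    isDiscreteMorse : IsDiscreteMorse f
    isDiscreteMorse = record { coface-unique = cofaces ; face-unique = faces }
      where
      cofaces : ∀ {σ τ τ′} → σ ≺ τ → f τ ≤ f σ → σ ≺ τ′ → f τ′ ≤ f σ → τ ≡ τ′
      cofaces p p≤ q q≤ with regular⇒matched p p≤ | regular⇒matched q q≤
      ... | i , i∈s , li , refl | j , j∈s , lj , refl =
        cong upper (mat i j i∈s j∈s (inj₁ (trans li (sym lj))))
      faces : ∀ {σ ν ν′} → ν ≺ σ → f σ ≤ f ν → ν′ ≺ σ → f σ ≤ f ν′ → ν ≡ ν′
      faces p p≤ q q≤ with regular⇒matched p p≤ | regular⇒matched q q≤
      ... | i , i∈s , refl , ui | j , j∈s , refl , uj =
        cong lower (mat i j i∈s j∈s (inj₂ (inj₁ (trans ui (sym uj)))))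

    regularPairs : ∀ i → i ∈ s ⇔ RegularPair f (primitivePair K i)
    regularPairs i = mk⇔
      (λ i∈s → primitivePair-≺ i , fromℕ-mono-≤ (ℕₚ.≤-reflexive
        (trans (value-upper (isUpper? (upper i)) i∈s) (sym (value-lower (isUpper? (lower i)) i∈s)))))
      λ (p , p≤) → let j , j∈s , l≡ , u≡ = regular⇒matched p p≤ in
        subst (_∈ s) (primitivePair-injective (cong₂ _,_ l≡ u≡)) j∈s

  morseFace⇔ : ∀ s → MorseFace K s ⇔ (Nonempty s × Matching s × Acyclic s)
  morseFace⇔ s = mk⇔
    (λ (ne , f , M) → ne , FromMorse.matching M , FromMorse.acyclic M)
    (λ (ne , mat , A) → ne , ToMorse.f mat A , ToMorse.isDiscreteMorse mat A , ToMorse.regularPairs mat A)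

  morseFace? : Decidable (MorseFace K)
  morseFace? s = map′ (Equivalence.from (morseFace⇔ s)) (Equivalence.to (morseFace⇔ s))
    (nonempty? s ×-dec (matching? s ×-dec acyclic? s))

  matching-⊆ : ∀ {s t} → s ⊆ t → Matching t → Matching s
  matching-⊆ s⊆t mat i j i∈s j∈s = mat i j (s⊆t i∈s) (s⊆t j∈s)

  acyclic-⊆ : ∀ {s t} → s ⊆ t → Acyclic t → Acyclic s
  acyclic-⊆ {s} {t} s⊆t A = record
    { potential  = potential
    ; bound      = bound
    ; bounded    = bounded
    ; decreasing = λ st → decreasing (vStep-⊆ st)
    }
    where
    open Acyclic A
    vStep-⊆ : ∀ {η ν} → VStep s η ν → VStep t η ν
    vStep-⊆ (i , i∈s , st) = i , s⊆t i∈s , st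

  morseFace-⊆ : ∀ {s t} → MorseFace K t → s ⊆ t → Nonempty s → MorseFace K s
  morseFace-⊆ {s} {t} (_ , f , M) s⊆t ne = Equivalence.from (morseFace⇔ s)
    (ne , matching-⊆ s⊆t (FromMorse.matching M) , acyclic-⊆ s⊆t (FromMorse.acyclic M))

  morseFace-⁅⁆ : ∀ i → MorseFace K ⁅ i ⁆
  morseFace-⁅⁆ i = Equivalence.from (morseFace⇔ ⁅ i ⁆) ((i , x∈⁅x⁆ i) , mat , record
    { potential  = λ σ → pot (lower i ≟ₛ σ)
    ; bound      = 2
    ; bounded    = λ σ → pot<2 (lower i ≟ₛ σ)
    ; decreasing = decr
    })
    where
    mat : Matching ⁅ i ⁆
    mat a b a∈ b∈ _ = trans (x∈⁅y⁆⇒x≡y i a∈) (sym (x∈⁅y⁆⇒x≡y i b∈))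

    pot : ∀ {σ} → Dec (lower i ≡ σ) → ℕ
    pot (yes _) = 1
    pot (no _)  = 0

    pot<2 : ∀ {σ} (d : Dec (lower i ≡ σ)) → pot d ℕ.< 2
    pot<2 (yes _) = s≤s (s≤s z≤n)
    pot<2 (no _)  = s≤s z≤n

    pot-< : ∀ {η ν} (d : Dec (lower i ≡ ν)) (e : Dec (lower i ≡ η)) →
            lower i ≡ η → ν ≢ η → pot d ℕ.< pot e
    pot-< (yes refl) _       refl ν≢η = contradiction refl ν≢η
    pot-< (no _)     (yes _) _    _   = s≤s z≤n
    pot-< (no _)     (no ¬e) e    _   = contradiction e ¬e

    decr : ∀ {η ν} → VStep ⁅ i ⁆ η ν → pot (lower i ≟ₛ ν) ℕ.< pot (lower i ≟ₛ η)
    decr {η} {ν} (j , j∈ , l≡η , _ , ν≢η) with x∈⁅y⁆⇒x≡y i j∈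
    ... | refl = pot-< (lower i ≟ₛ ν) (lower i ≟ₛ η) l≡η ν≢η

𝔐 : SimplicialComplex k → SimplicialComplex (lsuc 0ℓ ⊔ k)
𝔐 K = record
  { #vertices   = length (≺-pairs K)
  ; Face        = MorseFace K
  ; face?       = morseFace? K
  ; nonempty    = proj₁
  ; down-closed = morseFace-⊆ K
  ; vertex      = morseFace-⁅⁆ K
  }

-- Only the 1-skeleton of 𝔐 K is needed.  Two primitive Morse functions span
-- an edge of 𝔐 K exactly when their pairs share no simplex, so an isomorphism
-- 𝔐 K ≅ 𝔐 L is an isomorphism of the line graphs of the Hasse diagrams.  Hasse
-- diagrams are bipartite, hence it comes from an isomorphism F of the
-- undirected diagrams.  The 4-cycles of a Hasse diagram are its diamonds, so
-- whether F preserves the direction of an edge does not change across a square;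
-- together with connectedness this makes F globally order preserving or order
-- reversing.  In the first case F restricts to an isomorphism on vertices.  In
-- the second case F sends the vertices of K to facets of L and either both
-- complexes are the boundary of a simplex, or both are cycles of equal length,
-- on which F is turned into an isomorphism by a half-step rotation.

module Submission where

open import Defs

open import Level using (Level; _⊔_; Lift; lift)
open import Data.Bool using (Bool; false; not)
open import Data.Bool.Properties using (not-¬; not-involutive)
open import Data.Empty using (⊥-elim)
open import Data.Fin using (Fin; zero; suc; toℕ; fromℕ<; punchOut)
import Data.Fin.Properties as Finₚ
open import Data.Fin.Subset
  using (Subset; Nonempty; ∣_∣; _∈_; _∉_; _⊆_; _∪_; _-_; ⁅_⁆)
open import Data.Fin.Subset.Properties
open import Data.List using (length)
open import Data.Nat as ℕ using (ℕ; zero; suc; s≤s; z≤n; _∸_)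
import Data.Nat.Properties as ℕₚ
open import Data.Product using (Σ; ∃; ∃-syntax; _×_; _,_; proj₁; proj₂)
open import Data.Sum using (_⊎_; inj₁; inj₂; [_,_]′; swap)
import Data.Vec.Properties as Vecₚ
open import Function using (_∘_; case_of_)
open import Function.Bundles using (_↔_; _⇔_; mk⇔; mk↔ₛ′; module Inverse; module Equivalence)
open import Relation.Binary.Construct.Closure.ReflexiveTransitive using (Star; ε; _◅_; _◅◅_)
open import Relation.Binary.Definitions using (tri<; tri≈; tri>)
open import Relation.Binary.PropositionalEquality
  using (_≡_; _≢_; refl; sym; trans; cong; cong₂; subst; subst₂; ≢-sym)
open import Relation.Nullary using (¬_; Dec; yes; no; contradiction)
open import Relation.Nullary.Decidable using (¬?; _×-dec_; _⊎-dec_; decidable-stable)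

open Simplex using (vertices)
open SimplicialComplex using (#vertices; Face; down-closed; vertex)

private variable
  n : ℕ
  k ℓ : Level

-- Simpliciality enters mostly through one fact, `coface-determined`: two distinct simplices have at
-- most one common immediate coface. It makes 4-cycles diamonds, and it is why two disjoint pairs
-- always form an acyclic matching: a closed V-path through both would need two lower simplices with
-- two common cofaces. The order-reversing case splits by the dimension of the dual `to ⟦ v ⟧` of a
-- vertex. From dimension 2 on, two ridges of it meet, so the edges of `K` dual to them lie in a
-- triangle, and this forces the facets across the two ridges to add the same new vertex. In
-- dimension 1 the ridges are points that do not meet; only 2-regularity remains, which leaves room
-- for cycles. In neither case does `F` send vertices to vertices: for boundaries only the numbers
-- of vertices are compared, and for cycles a direction of travel has to be chosen. A single point
-- has no primitive Morse functions, hence no line graph to start from, and is treated apart.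

x∉p-x : ∀ {p : Subset n} {x} → x ∉ p - x
x∉p-x {p = p} {x} x∈ with x∈p⇒p-x⊂p (p─q⊆p p ⁅ x ⁆ x∈)
... | _ , y , y∈p , y∉ with y Finₚ.≟ x
...   | yes refl = y∉ x∈
...   | no  y≢x  = y∉ (x∈p∧x≢y⇒x∈p-y y∈p y≢x)

⊆∧∣≥∣⇒≡ : ∀ {p q : Subset n} → p ⊆ q → ∣ q ∣ ℕ.≤ ∣ p ∣ → p ≡ q
⊆∧∣≥∣⇒≡ {p = p} p⊆q q≤p = ⊆-antisym p⊆q λ {x} x∈q → decidable-stable (x ∈? p) λ x∉p →
  ℕₚ.<-irrefl refl (ℕₚ.<-≤-trans (p⊂q⇒∣p∣<∣q∣ (p⊆q , x , x∈q , x∉p)) q≤p)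

∣p∣≡1⇒unique : ∀ {p : Subset n} {x y} → ∣ p ∣ ≡ 1 → x ∈ p → y ∈ p → x ≡ y
∣p∣≡1⇒unique {p = p} {x} {y} eq x∈ y∈ = decidable-stable (x Finₚ.≟ y) λ x≢y →
  case trans (sym eq) (trans (∣p∣≡1+∣p-x∣ x∈)
    (cong suc (∣p∣≡1+∣p-x∣ (x∈p∧x≢y⇒x∈p-y y∈ (≢-sym x≢y))))) of λ ()

∣p∣≡suc⇒nonempty : ∀ {p : Subset n} {m} → ∣ p ∣ ≡ suc m → Nonempty p
∣p∣≡suc⇒nonempty {n} {p} eq = decidable-stable (nonempty? p) λ empty →
  case trans (sym eq) (trans (cong ∣_∣ (Empty-unique empty)) (∣⊥∣≡0 n)) of λ ()

-- The face relation: opposite vertices, cofaces and squares.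

module _ {K : SimplicialComplex k} where

  simplex-≡ : ∀ {σ τ : Simplex K} → vertices σ ≡ vertices τ → σ ≡ τ
  simplex-≡ {simplex _ _} {simplex _ _} refl = refl

  simplex-nonempty : ∀ (σ : Simplex K) → Nonempty (vertices σ)
  simplex-nonempty σ = SimplicialComplex.nonempty K (face K σ)

  ∣vertices∣ : ∀ (σ : Simplex K) → ∣ vertices σ ∣ ≡ suc (dim σ)
  ∣vertices∣ σ = let x , x∈ = simplex-nonempty σ in
    trans (∣p∣≡1+∣p-x∣ x∈) (cong suc (sym (cong (_∸ 1) (∣p∣≡1+∣p-x∣ x∈))))

  ⊆∧dim≡⇒≡ : ∀ {σ τ : Simplex K} → vertices σ ⊆ vertices τ → dim σ ≡ dim τ → σ ≡ τ
  ⊆∧dim≡⇒≡ {σ} {τ} σ⊆τ eq = simplex-≡ (⊆∧∣≥∣⇒≡ σ⊆τ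
    (ℕₚ.≤-reflexive (trans (∣vertices∣ τ) (trans (cong suc (sym eq)) (sym (∣vertices∣ σ))))))

  ≺⇒⊆ : ∀ {σ τ : Simplex K} → σ ≺ τ → vertices σ ⊆ vertices τ
  ≺⇒⊆ ((σ⊆τ , _) , _) = σ⊆τ

  ≺-dim : ∀ {σ τ : Simplex K} → σ ≺ τ → dim τ ≡ suc (dim σ)
  ≺-dim = _≺_.dim-1

  ≺-asym : ∀ {σ τ : Simplex K} → σ ≺ τ → ¬ τ ≺ σ
  ≺-asym σ≺τ τ≺σ = ℕₚ.m≢1+m+n _ {1} (trans (trans (≺-dim τ≺σ) (cong suc (≺-dim σ≺τ))) (cong suc (ℕₚ.+-comm 1 _)))

  ≺⇒≢ : ∀ {σ τ : Simplex K} → σ ≺ τ → σ ≢ τ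
  ≺⇒≢ σ≺σ refl = ≺-asym σ≺σ σ≺σ

  -- `σ` is the face of `τ` opposite to `x`, spelled out by memberships because the uses go vertex
  -- by vertex.
  record Missing (σ τ : Simplex K) (x : Fin (#vertices K)) : Set where
    field
      ∈τ    : x ∈ vertices τ
      ∉σ    : x ∉ vertices σ
      cover : ∀ {z} → z ∈ vertices τ → z ≢ x → z ∈ vertices σ
  open Missing public

  missing : ∀ {σ τ : Simplex K} → σ ≺ τ → ∃ (Missing σ τ)
  missing {σ} {τ} ((σ⊆τ , x , x∈τ , x∉σ) , eq) = x , record
    { ∈τ = x∈τ ; ∉σ = x∉σ
    ; cover = λ z∈τ z≢x → subst (_ ∈_) (sym σ≡τ-x) (x∈p∧x≢y⇒x∈p-y z∈τ z≢x) }
    where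
    σ≡τ-x : vertices σ ≡ vertices τ - x
    σ≡τ-x = ⊆∧∣≥∣⇒≡ (λ z∈σ → x∈p∧x≢y⇒x∈p-y (σ⊆τ z∈σ) λ { refl → x∉σ z∈σ })
      (ℕₚ.≤-reflexive (trans
        (ℕₚ.suc-injective (trans (sym (∣p∣≡1+∣p-x∣ x∈τ)) (trans (∣vertices∣ τ) (cong suc eq))))
        (sym (∣vertices∣ σ))))

  missing-injective : ∀ {σ σ′ τ : Simplex K} {x} → σ ≺ τ → σ′ ≺ τ →
                      Missing σ τ x → Missing σ′ τ x → σ ≡ σ′
  missing-injective σ≺τ σ′≺τ m m′ = ⊆∧dim≡⇒≡
    (λ z∈σ → cover m′ (≺⇒⊆ σ≺τ z∈σ) λ { refl → ∉σ m z∈σ })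
    (ℕₚ.suc-injective (trans (sym (≺-dim σ≺τ)) (≺-dim σ′≺τ)))

  delete : ∀ (τ : Simplex K) x → Nonempty (vertices τ - x) → Simplex K
  delete τ x ne = simplex (vertices τ - x) (down-closed K (face K τ) (p─q⊆p _ _) ne)

  delete-≺ : ∀ {τ : Simplex K} {x} ne → x ∈ vertices τ → delete τ x ne ≺ τ
  delete-≺ {τ} {x} ne x∈τ = x∈p⇒p-x⊂p x∈τ ,
    ℕₚ.suc-injective (trans (sym (∣vertices∣ τ))
      (trans (∣p∣≡1+∣p-x∣ x∈τ) (cong suc (∣vertices∣ (delete τ x ne)))))

  delete-missing : ∀ {τ : Simplex K} {x} ne → x ∈ vertices τ → Missing (delete τ x ne) τ x
  delete-missing {τ} {x} ne x∈τ = record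
    { ∈τ = x∈τ ; ∉σ = x∉p-x {p = vertices τ} ; cover = x∈p∧x≢y⇒x∈p-y {p = vertices τ} }

  delete-nonempty : ∀ {τ : Simplex K} {x d} → dim τ ≡ suc d → x ∈ vertices τ → Nonempty (vertices τ - x)
  delete-nonempty {τ} eq x∈τ = ∣p∣≡suc⇒nonempty (ℕₚ.suc-injective
    (trans (sym (∣p∣≡1+∣p-x∣ x∈τ)) (trans (∣vertices∣ τ) (cong suc eq))))

  ∃-opposite : ∀ {τ : Simplex K} {x d} → dim τ ≡ suc d → x ∈ vertices τ → ∃[ σ ] σ ≺ τ × Missing σ τ x
  ∃-opposite {τ} eq x∈τ = let ne = delete-nonempty {τ} eq x∈τ in
    _ , delete-≺ ne x∈τ , delete-missing ne x∈τ

  ∃-face : ∀ {τ : Simplex K} {d} → dim τ ≡ suc d → ∃[ σ ] σ ≺ τ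
  ∃-face {τ} eq = let x , x∈τ = simplex-nonempty τ ; σ , σ≺τ , _ = ∃-opposite {τ} eq x∈τ in σ , σ≺τ

  another-face : ∀ {σ τ : Simplex K} → σ ≺ τ → ∃[ σ′ ] σ′ ≺ τ × σ′ ≢ σ
  another-face {σ} {τ} σ≺τ = delete τ y (x , x∈) , delete-≺ (x , x∈) (≺⇒⊆ σ≺τ y∈σ) ,
    λ eq → ∉σ m (subst (λ ρ → x ∈ vertices ρ) eq x∈)
    where
    x = proj₁ (missing σ≺τ)
    m = proj₂ (missing σ≺τ)
    y = proj₁ (simplex-nonempty σ)
    y∈σ = proj₂ (simplex-nonempty σ)
    x∈ : x ∈ vertices τ - y
    x∈ = x∈p∧x≢y⇒x∈p-y (∈τ m) λ eq → ∉σ m (subst (_∈ vertices σ) (sym eq) y∈σ)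

  -- If `σ` and `σ′` omit `a` and `b`, then `τ` without both is a face of each; the positive
  -- dimension of `σ` keeps it nonempty.
  meet : ∀ {σ σ′ τ : Simplex K} {d} → dim σ ≡ suc d → σ ≺ τ → σ′ ≺ τ → σ ≢ σ′ →
         ∃[ ρ ] ρ ≺ σ × ρ ≺ σ′
  meet {σ} {σ′} {τ} dσ σ≺τ σ′≺τ σ≢σ′ with missing σ≺τ | missing σ′≺τ
  ... | a , ma | b , mb = ρ , ρ≺σ ,
    ((λ z∈ → cover mb (≺⇒⊆ σ≺τ (≺⇒⊆ ρ≺σ z∈)) λ { refl → x∉p-x z∈ }) ,
     a , cover mb (∈τ ma) a≢b , (∉σ ma ∘ ≺⇒⊆ ρ≺σ)) ,
    trans (ℕₚ.suc-injective (trans (sym (≺-dim σ′≺τ)) (≺-dim σ≺τ))) (≺-dim ρ≺σ)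
    where
    a≢b : a ≢ b
    a≢b refl = σ≢σ′ (missing-injective σ≺τ σ′≺τ ma mb)
    b∈σ : b ∈ vertices σ
    b∈σ = cover ma (∈τ mb) (≢-sym a≢b)
    ne : Nonempty (vertices σ - b)
    ne = delete-nonempty {σ} dσ b∈σ
    ρ : Simplex K
    ρ = delete σ b ne
    ρ≺σ : ρ ≺ σ
    ρ≺σ = delete-≺ ne b∈σ

  -- The one vertex of `τ` outside `σ` lies in `σ′`, so `τ` is the union of `σ` and `σ′`.
  coface-determined : ∀ {σ σ′ τ τ′ : Simplex K} → σ ≺ τ → σ′ ≺ τ → σ ≢ σ′ → σ ≺ τ′ → σ′ ≺ τ′ → τ ≡ τ′
  coface-determined {σ} {σ′} {τ} {τ′} σ≺τ σ′≺τ σ≢σ′ σ≺τ′ σ′≺τ′ with missing σ≺τ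
  ... | x , m = ⊆∧dim≡⇒≡ τ⊆τ′ (trans (≺-dim σ≺τ) (sym (≺-dim σ≺τ′)))
    where
    x∈σ′ : x ∈ vertices σ′
    x∈σ′ = decidable-stable (x ∈? vertices σ′) λ x∉σ′ → σ≢σ′ (sym (⊆∧dim≡⇒≡
      (λ z∈ → cover m (≺⇒⊆ σ′≺τ z∈) λ { refl → x∉σ′ z∈ })
      (ℕₚ.suc-injective (trans (sym (≺-dim σ′≺τ)) (≺-dim σ≺τ)))))
    τ⊆τ′ : vertices τ ⊆ vertices τ′
    τ⊆τ′ {z} z∈τ with z Finₚ.≟ x
    ... | yes refl = ≺⇒⊆ σ′≺τ′ x∈σ′
    ... | no  z≢x  = ≺⇒⊆ σ≺τ′ (cover m z∈τ z≢x)

  -- A third face would omit a third vertex; then `ρ`, which omits only `p`, would contain both `q`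
  -- and `r`.
  edge-faces : ∀ {ρ ρ′ ρ″ τ : Simplex K} → dim ρ ≡ 0 → ρ ≺ τ → ρ′ ≺ τ → ρ ≢ ρ′ → ρ″ ≺ τ →
               ρ″ ≡ ρ ⊎ ρ″ ≡ ρ′
  edge-faces {ρ} {ρ′} {ρ″} dρ ρ≺ ρ′≺ ρ≢ρ′ ρ″≺ with missing ρ≺ | missing ρ′≺ | missing ρ″≺
  ... | p , mp | q , mq | r , mr with r Finₚ.≟ p | r Finₚ.≟ q
  ...   | yes refl | _        = inj₁ (missing-injective ρ″≺ ρ≺ mr mp)
  ...   | no _     | yes refl = inj₂ (missing-injective ρ″≺ ρ′≺ mr mq)
  ...   | no r≢p   | no r≢q   = contradiction
    (∣p∣≡1⇒unique (trans (∣vertices∣ ρ) (cong suc dρ)) (cover mp (∈τ mr) r≢p)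
      (cover mp (∈τ mq) λ { refl → ρ≢ρ′ (missing-injective ρ≺ ρ′≺ mp mq) })) r≢q

  ⟦_⟧ : Fin (#vertices K) → Simplex K
  ⟦ v ⟧ = simplex ⁅ v ⁆ (vertex K v)

  dim-⟦⟧ : ∀ v → dim ⟦ v ⟧ ≡ 0
  dim-⟦⟧ v = cong (_∸ 1) (∣⁅x⁆∣≡1 v)

  ⟦⟧-injective : ∀ {u v} → ⟦ u ⟧ ≡ ⟦ v ⟧ → u ≡ v
  ⟦⟧-injective {u} {v} eq = x∈⁅y⁆⇒x≡y v (subst (λ σ → u ∈ vertices σ) eq (x∈⁅x⁆ u))

  ∈⇒⟦⟧⊆ : ∀ {v} {p : Subset (#vertices K)} → v ∈ p → ⁅ v ⁆ ⊆ p
  ∈⇒⟦⟧⊆ {v} v∈ x∈ = subst (_∈ _) (sym (x∈⁅y⁆⇒x≡y v x∈)) v∈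

  dim≡0⇒⟦⟧ : ∀ {σ : Simplex K} {v} → dim σ ≡ 0 → v ∈ vertices σ → σ ≡ ⟦ v ⟧
  dim≡0⇒⟦⟧ {v = v} dσ v∈ = sym (⊆∧dim≡⇒≡ (∈⇒⟦⟧⊆ v∈) (trans (dim-⟦⟧ v) (sym dσ)))

  dim≡0⇒∃ : ∀ (σ : Simplex K) → dim σ ≡ 0 → ∃[ v ] σ ≡ ⟦ v ⟧
  dim≡0⇒∃ σ dσ = let v , v∈ = simplex-nonempty σ in v , dim≡0⇒⟦⟧ dσ v∈

  dim≡0⇒minimal : ∀ {σ τ : Simplex K} → dim τ ≡ 0 → ¬ σ ≺ τ
  dim≡0⇒minimal dτ σ≺τ = case trans (sym dτ) (≺-dim σ≺τ) of λ ()

  minimal⇒dim≡0 : ∀ {τ : Simplex K} → (∀ σ → ¬ σ ≺ τ) → dim τ ≡ 0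
  minimal⇒dim≡0 {τ} min = go (dim τ) refl
    where
    go : ∀ d → dim τ ≡ d → dim τ ≡ 0
    go zero    eq = eq
    go (suc d) eq = let σ , σ≺τ = ∃-face eq in contradiction σ≺τ (min σ)

  ⊆⇒≺* : ∀ {σ τ : Simplex K} → vertices σ ⊆ vertices τ → Star _≺_ σ τ
  ⊆⇒≺* {σ} {τ} = go (dim τ) refl
    where
    go : ∀ d {τ} → dim τ ≡ d → vertices σ ⊆ vertices τ → Star _≺_ σ τ
    go d {τ} dτ σ⊆τ with Finₚ.any? (λ x → (x ∈? vertices τ) ×-dec ¬? (x ∈? vertices σ))
    ... | no ∄ = subst (Star _≺_ σ) (simplex-≡ (⊆-antisym σ⊆τ
      λ {x} x∈τ → decidable-stable (x ∈? vertices σ) λ x∉σ → ∄ (x , x∈τ , x∉σ))) ε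
    ... | yes (x , x∈τ , x∉σ) = step d dτ
      where
      σ⊆ : vertices σ ⊆ vertices τ - x
      σ⊆ z∈σ = x∈p∧x≢y⇒x∈p-y (σ⊆τ z∈σ) λ { refl → x∉σ z∈σ }
      ne : Nonempty (vertices τ - x)
      ne = let z , z∈ = simplex-nonempty σ in z , σ⊆ z∈
      τ-x≺τ : delete τ x ne ≺ τ
      τ-x≺τ = delete-≺ ne x∈τ
      step : ∀ d → dim τ ≡ d → Star _≺_ σ τ
      step zero    dτ = contradiction τ-x≺τ (dim≡0⇒minimal dτ)
      step (suc d) dτ = go d (ℕₚ.suc-injective (trans (sym (≺-dim τ-x≺τ)) dτ)) σ⊆ ◅◅ (τ-x≺τ ◅ ε)

  infix 4 _~_

  _~_ : Simplex K → Simplex K → Set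
  σ ~ τ = σ ≺ τ ⊎ τ ≺ σ

  -- Around a 4-cycle the dimension changes by one at each step and returns, so it rises exactly
  -- twice. Alternating rises would give two simplices with two common cofaces; hence the rises are
  -- consecutive and opposite sides agree.
  square-parallel : ∀ {a b c d : Simplex K} → a ≢ c → b ≢ d → a ≺ b → b ~ c → c ~ d → d ~ a → d ≺ c
  square-parallel a≢c b≢d a≺b _ (inj₂ d≺c) _ = d≺c
  square-parallel a≢c b≢d a≺b (inj₂ c≺b) (inj₁ c≺d) (inj₂ a≺d) =
    contradiction (coface-determined a≺b c≺b a≢c a≺d c≺d) b≢d
  square-parallel a≢c b≢d a≺b (inj₂ c≺b) (inj₁ c≺d) (inj₁ d≺a) = ⊥-elim (ℕₚ.<-irrefl refl (begin-strict
    _ <⟨ ≺-dim-< d≺a ⟩ _ <⟨ ≺-dim-< a≺b ⟩ _ ≡⟨ ≺-dim c≺b ⟩ _ ≡⟨ ≺-dim c≺d ⟨ _ ∎))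
    where
    open ℕₚ.≤-Reasoning
    ≺-dim-< : ∀ {σ τ : Simplex K} → σ ≺ τ → dim σ ℕ.< dim τ
    ≺-dim-< σ≺τ = ℕₚ.≤-reflexive (sym (≺-dim σ≺τ))
  square-parallel {a} {b} {c} {d} a≢c b≢d a≺b (inj₁ b≺c) (inj₁ c≺d) d~a = ⊥-elim (go d~a)
    where
    dd : dim d ≡ 3 ℕ.+ dim a
    dd = trans (≺-dim c≺d) (cong suc (trans (≺-dim b≺c) (cong suc (≺-dim a≺b))))
    go : ¬ d ~ a
    go (inj₁ d≺a) = ℕₚ.m≢1+n+m (dim a) {3} (trans (≺-dim d≺a) (cong suc dd))
    go (inj₂ a≺d) = ℕₚ.m≢1+n+m (dim a) {1} (ℕₚ.suc-injective (trans (sym (≺-dim a≺d)) dd))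

-- Isomorphisms of undirected Hasse diagrams and the directions of edges.

record HasseIso (K : SimplicialComplex k) (L : SimplicialComplex ℓ) : Set (k ⊔ ℓ) where
  field
    to      : Simplex K → Simplex L
    from    : Simplex L → Simplex K
    from∘to : ∀ σ → from (to σ) ≡ σ
    to∘from : ∀ σ → to (from σ) ≡ σ
    to-≺    : ∀ {σ τ} → σ ≺ τ → to σ ~ to τ
    from-≺  : ∀ {σ τ} → σ ≺ τ → from σ ~ from τ

  to-injective : ∀ {σ τ} → to σ ≡ to τ → σ ≡ τ
  to-injective eq = trans (sym (from∘to _)) (trans (cong from eq) (from∘to _))

  to-~ : ∀ {σ τ} → σ ~ τ → to σ ~ to τ
  to-~ (inj₁ σ≺τ) = to-≺ σ≺τ
  to-~ (inj₂ τ≺σ) = swap (to-≺ τ≺σ)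

hasseSym : ∀ {K : SimplicialComplex k} {L : SimplicialComplex ℓ} → HasseIso K L → HasseIso L K
hasseSym F = record
  { to = from ; from = to ; from∘to = to∘from ; to∘from = from∘to ; to-≺ = from-≺ ; from-≺ = to-≺ }
  where open HasseIso F

module Orientation {K : SimplicialComplex k} {L : SimplicialComplex ℓ} (F : HasseIso K L) where
  open HasseIso F

  Up Down : Simplex K → Simplex K → Set
  Up   σ τ = to σ ≺ to τ
  Down σ τ = to τ ≺ to σ

  Up-parallel : ∀ {a b c d} → a ≢ c → b ≢ d → Up a b → b ~ c → c ~ d → d ~ a → Up d c
  Up-parallel a≢c b≢d up b~c c~d d~a =
    square-parallel (a≢c ∘ to-injective) (b≢d ∘ to-injective) up (to-~ b~c) (to-~ c~d) (to-~ d~a)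

  -- A chain in L is completed to a diamond, which F⁻¹ maps to a square.
  complete-chain : ∀ {σ τ ω} → Up σ τ → Up τ ω → ∃[ ρ ] τ ≢ ρ × σ ~ ρ × ρ ~ ω
  complete-chain {σ} {τ} {ω} σ<τ τ<ω with diamond L σ<τ τ<ω
  ... | ρ , σ≺ρ , ρ≺ω , τ≢ρ = from ρ ,
    (λ τ≡ → τ≢ρ (trans (cong to τ≡) (to∘from ρ))) ,
    subst (_~ from ρ) (from∘to σ) (from-≺ σ≺ρ) ,
    subst (from ρ ~_) (from∘to ω) (from-≺ ρ≺ω)

  -- If the ends of the edge `τ` behaved differently, their images would form a chain through
  -- `to τ`. Completing it yields `ρ`, a second edge with the same two ends.
  Up-edge : ∀ {σ σ′ τ} → dim σ ≡ 0 → σ ≺ τ → σ′ ≺ τ → Up σ τ → Up σ′ τ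
  Up-edge {σ} {σ′} {τ} dσ σ≺τ σ′≺τ up with to-≺ σ′≺τ
  ... | inj₁ up′  = up′
  ... | inj₂ down with complete-chain up down
  ...   | ρ , τ≢ρ , inj₂ ρ≺σ , _          = contradiction ρ≺σ (dim≡0⇒minimal dσ)
  ...   | ρ , τ≢ρ , inj₁ σ≺ρ , inj₁ ρ≺σ′  = contradiction ρ≺σ′ (dim≡0⇒minimal
    (trans (ℕₚ.suc-injective (trans (sym (≺-dim σ′≺τ)) (≺-dim σ≺τ))) dσ))
  ...   | ρ , τ≢ρ , inj₁ σ≺ρ , inj₂ σ′≺ρ  = contradiction
    (coface-determined σ≺τ σ′≺τ (λ { refl → ≺-asym up down }) σ≺ρ σ′≺ρ) τ≢ρ

  -- The third edge e″ of t shares a vertex with each of e and e′.  The three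
  -- squares inside t and Up-edge at e″ carry the direction from one to the other.
  Up-triangle : ∀ {v e e′ t} → dim v ≡ 0 → v ≺ e → v ≺ e′ → e ≢ e′ → e ≺ t → e′ ≺ t →
                Up v e → Up v e′
  Up-triangle {v} {e} {e′} {t} dv v≺e v≺e′ e≢e′ e≺t e′≺t up
    with another-face v≺e
  ... | x , x≺e , x≢v with diamond K x≺e e≺t
  ...   | e″ , x≺e″ , e″≺t , e≢e″ with meet de″ e″≺t e′≺t e″≢e′
    where
    de″ : dim e″ ≡ 1
    de″ = trans (ℕₚ.suc-injective (trans (sym (≺-dim e″≺t)) (≺-dim e≺t)))
      (trans (≺-dim v≺e) (cong suc dv))
    e″≢e′ : e″ ≢ e′
    e″≢e′ refl = e≢e′ (coface-determined v≺e x≺e (≢-sym x≢v) v≺e′ x≺e″)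
  ...     | y , y≺e″ , y≺e′ = Up-parallel e≢e′ (≺²⇒≢ v≺e e≺t ∘ sym) up₄ (inj₂ e′≺t) (inj₂ v≺e′) (inj₁ v≺e)
    where
    ≺²⇒≢ : ∀ {σ τ ρ : Simplex K} → σ ≺ τ → τ ≺ ρ → σ ≢ ρ
    ≺²⇒≢ σ≺τ τ≺σ refl = ≺-asym σ≺τ τ≺σ
    e″≢e′ : e″ ≢ e′
    e″≢e′ refl = e≢e′ (coface-determined v≺e x≺e (≢-sym x≢v) v≺e′ x≺e″)
    dy : dim y ≡ 0
    dy = trans (ℕₚ.suc-injective (trans (sym (≺-dim y≺e′)) (≺-dim v≺e′))) dv
    up₁ : Up e′ t
    up₁ = Up-parallel (≺²⇒≢ v≺e e≺t) e≢e′ up (inj₁ e≺t) (inj₂ e′≺t) (inj₂ v≺e′)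
    up₂ : Up y e″
    up₂ = Up-parallel (≢-sym e″≢e′) (≺²⇒≢ y≺e′ e′≺t ∘ sym) up₁ (inj₂ e″≺t) (inj₂ y≺e″) (inj₁ y≺e′)
    up₃ : Up x e″
    up₃ = Up-edge dy y≺e″ x≺e″ up₂
    up₄ : Up e t
    up₄ = Up-parallel (≺²⇒≢ x≺e e≺t) (≢-sym e≢e″) up₃ (inj₁ e″≺t) (inj₂ e≺t) (inj₂ x≺e)

  -- If `e` and `e′` behaved differently, completing the chain through `to v` would give `t`
  -- adjacent to both. Below both it would be a second common end; above both it is a triangle, the
  -- case of `Up-triangle`; dimensions exclude the rest.
  Up-vertex : ∀ {v e e′} → dim v ≡ 0 → v ≺ e → v ≺ e′ → Up v e → Up v e′
  Up-vertex {v} {e} {e′} dv v≺e v≺e′ up with to-≺ v≺e′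
  ... | inj₁ up′  = up′
  ... | inj₂ down with complete-chain down up
  ...   | t , v≢t , inj₁ e′≺t , inj₁ t≺e = contradiction
    (trans (≺-dim v≺e) (cong suc dv))
    λ de → case trans (sym de) (trans (≺-dim t≺e) (cong suc (trans (≺-dim e′≺t) (cong suc (≺-dim v≺e′))))) of λ ()
  ...   | t , v≢t , inj₁ e′≺t , inj₂ e≺t = Up-triangle dv v≺e v≺e′ (λ { refl → ≺-asym up down }) e≺t e′≺t up
  ...   | t , v≢t , inj₂ t≺e′ , inj₁ t≺e = contradiction down
    (subst (λ e → ¬ Down v e) (coface-determined v≺e t≺e v≢t v≺e′ t≺e′) (≺-asym up))
  ...   | t , v≢t , inj₂ t≺e′ , inj₂ e≺t =
    case trans (sym (trans (≺-dim v≺e′) (cong suc dv))) (trans (≺-dim t≺e′) (cong suc (≺-dim e≺t))) of λ ()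

  -- A face `ρ` of `σ` and the diamond over it make `σ ≺ τ` parallel to `ρ ≺ σ′` one dimension
  -- lower. `Up-constant` needs one implication at each of its two ends.
  reduce : ∀ d {σ τ} → dim σ ≡ d → σ ≺ τ →
           Σ (Simplex K) λ v → Σ (Simplex K) λ e → dim v ≡ 0 × v ≺ e × (Up v e → Up σ τ) × (Up σ τ → Up v e)
  reduce zero    {σ} {τ} dσ σ≺τ = σ , τ , dσ , σ≺τ , (λ up → up) , (λ up → up)
  reduce (suc d) {σ} {τ} dσ σ≺τ with ∃-face dσ
  ... | ρ , ρ≺σ with diamond K ρ≺σ σ≺τ
  ...   | σ′ , ρ≺σ′ , σ′≺τ , σ≢σ′ with reduce d (ℕₚ.suc-injective (trans (sym (≺-dim ρ≺σ)) dσ)) ρ≺σ′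
  ...     | v , e , dv , v≺e , f , g = v , e , dv , v≺e ,
    (λ up → Up-parallel ρ≢τ (≢-sym σ≢σ′) (f up) (inj₁ σ′≺τ) (inj₂ σ≺τ) (inj₂ ρ≺σ)) ,
    (λ up → g (Up-parallel σ≢σ′ (≢-sym ρ≢τ) up (inj₂ σ′≺τ) (inj₂ ρ≺σ′) (inj₁ ρ≺σ)))
    where
    ρ≢τ : ρ ≢ τ
    ρ≢τ refl = ≺-asym ρ≺σ σ≺τ

-- Edges, connectedness as induction on vertices, and constancy of the direction.

module _ (K : SimplicialComplex k) where

  pair : ∀ {u v} → Adjacent K u v → Simplex K
  pair {u} {v} uv = simplex (⁅ u ⁆ ∪ ⁅ v ⁆) uv

  module _ {u v} (uv : Adjacent K u v) (u≢v : u ≢ v) where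

    ∣⁅u⁆∪⁅v⁆∣≡2 : ∣ ⁅ u ⁆ ∪ ⁅ v ⁆ ∣ ≡ 2
    ∣⁅u⁆∪⁅v⁆∣≡2 = trans (∣p∣≡1+∣p-x∣ (x∈p∪q⁺ (inj₁ (x∈⁅x⁆ u)))) (cong suc
      (trans (cong ∣_∣ (⊆-antisym left right)) (∣⁅x⁆∣≡1 v)))
      where
      left : (⁅ u ⁆ ∪ ⁅ v ⁆) - u ⊆ ⁅ v ⁆
      left x∈ with x∈p∪q⁻ _ _ (p─q⊆p _ ⁅ u ⁆ x∈)
      ... | inj₂ x∈v = x∈v
      ... | inj₁ x∈u with x∈⁅y⁆⇒x≡y u x∈u
      ...   | refl = contradiction x∈ x∉p-x
      right : ⁅ v ⁆ ⊆ (⁅ u ⁆ ∪ ⁅ v ⁆) - u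
      right x∈v with x∈⁅y⁆⇒x≡y v x∈v
      ... | refl = x∈p∧x≢y⇒x∈p-y (x∈p∪q⁺ (inj₂ x∈v)) (≢-sym u≢v)

    ≺-pairˡ : ⟦ u ⟧ ≺ pair uv
    ≺-pairˡ = ((λ x∈ → x∈p∪q⁺ (inj₁ x∈)) , v , x∈p∪q⁺ (inj₂ (x∈⁅x⁆ v)) , λ v∈u → u≢v (sym (x∈⁅y⁆⇒x≡y u v∈u))) ,
      trans (cong (_∸ 1) ∣⁅u⁆∪⁅v⁆∣≡2) (cong suc (sym (dim-⟦⟧ {K = K} u)))

    ≺-pairʳ : ⟦ v ⟧ ≺ pair uv
    ≺-pairʳ = ((λ x∈ → x∈p∪q⁺ (inj₂ x∈)) , u , x∈p∪q⁺ (inj₁ (x∈⁅x⁆ u)) , λ u∈v → u≢v (x∈⁅y⁆⇒x≡y v u∈v)) ,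
      trans (cong (_∸ 1) ∣⁅u⁆∪⁅v⁆∣≡2) (cong suc (sym (dim-⟦⟧ {K = K} v)))

module _ (K : SimplicialComplex k) (conn : ∀ u v → Star (Adjacent K) u v) where

  vertex-induction : ∀ {p} (P : Fin (#vertices K) → Set p) →
    (∀ {u v} → u ≢ v → ∀ e → ⟦ u ⟧ ≺ e → ⟦ v ⟧ ≺ e → P u → P v) → ∀ {u} → P u → ∀ v → P v
  vertex-induction P step {u} Pu v = go (conn u v) Pu
    where
    go : ∀ {u} → Star (Adjacent K) u v → P u → P v
    go ε Pu = Pu
    go {u} (_◅_ {j = w} uw ws) Pu with u Finₚ.≟ w
    -- Singletons are faces, so `Adjacent` is reflexive and a path may pause.
    ... | yes refl = go ws Pu
    ... | no  u≢w  = go ws (step u≢w (pair K uw) (≺-pairˡ K uw u≢w) (≺-pairʳ K uw u≢w) Pu)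

module _ {K : SimplicialComplex k} {L : SimplicialComplex ℓ} (conn : ∀ u v → Star (Adjacent K) u v)
         (F : HasseIso K L) where
  open HasseIso F
  open Orientation F

  private
    Up-bottom : ∀ {v e v′ e′} → dim v ≡ 0 → dim v′ ≡ 0 → v ≺ e → v′ ≺ e′ → Up v e → Up v′ e′
    Up-bottom {v} {e} {v′} dv dv′ v≺e v′≺e′ up with dim≡0⇒∃ v dv | dim≡0⇒∃ v′ dv′
    -- The predicate concerns all edges at `w`: `Up-edge` passes to the other end of an edge,
    -- `Up-vertex` then turns around that end.
    ... | u , refl | u′ , refl = vertex-induction K conn (λ w → ∀ {e} → ⟦ w ⟧ ≺ e → Up ⟦ w ⟧ e)
      (λ {a} {b} _ e a≺e b≺e Pa {e′} b≺e′ →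
        Up-vertex (dim-⟦⟧ {K = K} b) b≺e b≺e′ (Up-edge (dim-⟦⟧ {K = K} a) a≺e b≺e (Pa a≺e)))
      (λ u≺e′ → Up-vertex (dim-⟦⟧ {K = K} u) v≺e u≺e′ up) u′ v′≺e′

  Up-constant : ∀ {σ τ σ′ τ′} → σ ≺ τ → σ′ ≺ τ′ → Up σ τ → Up σ′ τ′
  Up-constant σ≺τ σ′≺τ′ up with reduce _ refl σ≺τ | reduce _ refl σ′≺τ′
  ... | v , e , dv , v≺e , _ , g | v′ , e′ , dv′ , v′≺e′ , f′ , _ =
    f′ (Up-bottom dv dv′ v≺e v′≺e′ (g up))

  orientation : ∀ {σ τ} → σ ≺ τ → (∀ {σ τ} → σ ≺ τ → Up σ τ) ⊎ (∀ {σ τ} → σ ≺ τ → Down σ τ)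
  orientation σ≺τ with to-≺ σ≺τ
  ... | inj₁ up   = inj₁ λ σ′≺τ′ → Up-constant σ≺τ σ′≺τ′ up
  ... | inj₂ down = inj₂ λ σ′≺τ′ → case to-≺ σ′≺τ′ of λ
    { (inj₁ up)    → contradiction down (≺-asym (Up-constant σ′≺τ′ σ≺τ up))
    ; (inj₂ down′) → down′ }

-- Order-preserving isomorphisms.

∈-image⁺ : ∀ {m n} (φ : Fin n ↔ Fin m) {p j} → Inverse.from φ j ∈ p → j ∈ image φ p
∈-image⁺ φ {p} {j} j∈ = Vecₚ.lookup⇒[]= j _ (trans (Vecₚ.lookup∘tabulate _ j) (Vecₚ.[]=⇒lookup j∈))

∈-image⁻ : ∀ {m n} (φ : Fin n ↔ Fin m) {p j} → j ∈ image φ p → Inverse.from φ j ∈ p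
∈-image⁻ φ {p} {j} j∈ = Vecₚ.lookup⇒[]= _ p (trans (sym (Vecₚ.lookup∘tabulate _ j)) (Vecₚ.[]=⇒lookup j∈))

∈-pair⁻ : ∀ {u v x : Fin n} → x ∈ ⁅ u ⁆ ∪ ⁅ v ⁆ → x ≡ u ⊎ x ≡ v
∈-pair⁻ {u = u} {v} x∈ with x∈p∪q⁻ _ _ x∈
... | inj₁ x∈u = inj₁ (x∈⁅y⁆⇒x≡y u x∈u)
... | inj₂ x∈v = inj₂ (x∈⁅y⁆⇒x≡y v x∈v)

∈-pairˡ : ∀ (u v : Fin n) → u ∈ ⁅ u ⁆ ∪ ⁅ v ⁆
∈-pairˡ u v = x∈p∪q⁺ (inj₁ (x∈⁅x⁆ u))

∈-pairʳ : ∀ (u v : Fin n) → v ∈ ⁅ u ⁆ ∪ ⁅ v ⁆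
∈-pairʳ u v = x∈p∪q⁺ (inj₂ (x∈⁅x⁆ v))

image-pair : ∀ {m n} (φ : Fin n ↔ Fin m) u v →
             image φ (⁅ u ⁆ ∪ ⁅ v ⁆) ≡ ⁅ Inverse.to φ u ⁆ ∪ ⁅ Inverse.to φ v ⁆
image-pair φ u v = ⊆-antisym left right
  where
  open Inverse φ
  left : image φ (⁅ u ⁆ ∪ ⁅ v ⁆) ⊆ ⁅ to u ⁆ ∪ ⁅ to v ⁆
  left {x} x∈ with ∈-pair⁻ (∈-image⁻ φ x∈)
  ... | inj₁ eq = subst (_∈ _) (strictlyInverseˡ x) (subst (λ y → to y ∈ _) (sym eq) (∈-pairˡ (to u) (to v)))
  ... | inj₂ eq = subst (_∈ _) (strictlyInverseˡ x) (subst (λ y → to y ∈ _) (sym eq) (∈-pairʳ (to u) (to v)))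
  right : ⁅ to u ⁆ ∪ ⁅ to v ⁆ ⊆ image φ (⁅ u ⁆ ∪ ⁅ v ⁆)
  right {x} x∈ with ∈-pair⁻ x∈
  ... | inj₁ refl = ∈-image⁺ φ (subst (_∈ ⁅ u ⁆ ∪ ⁅ v ⁆) (sym (strictlyInverseʳ u)) (∈-pairˡ u v))
  ... | inj₂ refl = ∈-image⁺ φ (subst (_∈ ⁅ u ⁆ ∪ ⁅ v ⁆) (sym (strictlyInverseʳ v)) (∈-pairʳ u v))

module OrderPreserving {K : SimplicialComplex k} {L : SimplicialComplex ℓ} (F : HasseIso K L)
                       (mono : ∀ {σ τ} → σ ≺ τ → HasseIso.to F σ ≺ HasseIso.to F τ) where
  open HasseIso F

  from-mono : ∀ {σ τ} → σ ≺ τ → from σ ≺ from τ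
  from-mono {σ} {τ} σ≺τ with from-≺ σ≺τ
  ... | inj₁ up   = up
  ... | inj₂ down = contradiction (subst₂ _≺_ (to∘from τ) (to∘from σ) (mono down)) (≺-asym σ≺τ)

  to-⊆ : ∀ {σ τ} → vertices σ ⊆ vertices τ → vertices (to σ) ⊆ vertices (to τ)
  to-⊆ σ⊆τ = go (⊆⇒≺* σ⊆τ)
    where
    go : ∀ {σ τ} → Star _≺_ σ τ → vertices (to σ) ⊆ vertices (to τ)
    go ε x∈ = x∈
    go (σ≺ρ ◅ ρ≺*τ) x∈ = go ρ≺*τ (≺⇒⊆ (mono σ≺ρ) x∈)

  to-⟦⟧ : ∀ v → ∃[ w ] to ⟦ v ⟧ ≡ ⟦ w ⟧
  to-⟦⟧ v = dim≡0⇒∃ (to ⟦ v ⟧) (minimal⇒dim≡0 λ σ σ≺ →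
    dim≡0⇒minimal (dim-⟦⟧ {K = K} v) (subst (from σ ≺_) (from∘to _) (from-mono σ≺)))

  toVertex : Fin (#vertices K) → Fin (#vertices L)
  toVertex v = proj₁ (to-⟦⟧ v)

  toVertex-∈ : ∀ {v} σ → v ∈ vertices σ → toVertex v ∈ vertices (to σ)
  toVertex-∈ {v} σ v∈σ = to-⊆ {⟦ v ⟧} {σ} (∈⇒⟦⟧⊆ {K = K} v∈σ)
    (subst (λ ρ → toVertex v ∈ vertices ρ) (sym (proj₂ (to-⟦⟧ v))) (x∈⁅x⁆ (toVertex v)))

module _ {K : SimplicialComplex k} {L : SimplicialComplex ℓ} (F : HasseIso K L)
         (mono : ∀ {σ τ} → σ ≺ τ → HasseIso.to F σ ≺ HasseIso.to F τ) where
  open HasseIso F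
  private
    module T = OrderPreserving F mono
    module S = OrderPreserving (hasseSym F) T.from-mono
    f = T.toVertex
    g = S.toVertex

    g∘f : ∀ v → g (f v) ≡ v
    g∘f v = ⟦⟧-injective {K = K} (trans (sym (proj₂ (S.to-⟦⟧ (f v))))
      (trans (cong from (sym (proj₂ (T.to-⟦⟧ v)))) (from∘to ⟦ v ⟧)))

    f∘g : ∀ w → f (g w) ≡ w
    f∘g w = ⟦⟧-injective {K = L} (trans (sym (proj₂ (T.to-⟦⟧ (g w))))
      (trans (cong to (sym (proj₂ (S.to-⟦⟧ w)))) (to∘from ⟦ w ⟧)))

  -- The image of a face `p` is the vertex set of `to` of `p`; conversely, if the image of `p` is a
  -- face, then `p` is the vertex set of `from` of it.
  orderPreserving⇒≅ : K ≅ L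
  orderPreserving⇒≅ = record
    { vertices↔ = φ
    ; face⇔ = λ p → mk⇔
        (λ face-p → let σ = simplex p face-p in subst (Face L) (⊆-antisym
          (λ {j} j∈ → ∈-image⁺ φ (subst (λ ρ → g j ∈ vertices ρ) (from∘to σ) (S.toVertex-∈ (to σ) j∈)))
          (λ {j} j∈ → subst (_∈ _) (f∘g j) (T.toVertex-∈ σ (∈-image⁻ φ j∈))))
          (face L (to σ)))
        (λ face-q → let τ = simplex (image φ p) face-q in subst (Face K) (⊆-antisym
          (λ {i} i∈ → subst (_∈ p) (g∘f i)
            (∈-image⁻ φ (subst (λ ρ → f i ∈ vertices ρ) (to∘from τ) (T.toVertex-∈ (from τ) i∈))))
          (λ {i} i∈ → subst (_∈ _) (g∘f i)
            (S.toVertex-∈ τ (∈-image⁺ φ (subst (_∈ p) (sym (g∘f i)) i∈)))))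
          (face K (from τ)))
    }
    where
    φ : Fin (#vertices K) ↔ Fin (#vertices L)
    φ = mk↔ₛ′ f g f∘g g∘f

-- The line graph of the Hasse diagram and the 1-skeleton of `𝔐`.

#primitives : SimplicialComplex k → ℕ
#primitives K = length (≺-pairs K)

-- The parity of the dimension is the 2-colouring of the Hasse diagram.
odd : ℕ → Bool
odd zero    = false
odd (suc m) = not (odd m)

module _ (K : SimplicialComplex k) where

  Inc : Fin (#primitives K) → Simplex K → Set k
  Inc e σ = lower K e ≡ σ ⊎ upper K e ≡ σ

  inc? : ∀ e σ → Dec (Inc e σ)
  inc? e σ = (lower K e ≟ₛ σ) ⊎-dec (upper K e ≟ₛ σ)

  -- Adjacency in the line graph, with a loop at every edge. Listing the ends of `e` makes it
  -- decidable without a search for the common simplex.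
  Touch : Fin (#primitives K) → Fin (#primitives K) → Set k
  Touch e e′ = Inc e′ (lower K e) ⊎ Inc e′ (upper K e)

  touch? : ∀ e e′ → Dec (Touch e e′)
  touch? e e′ = inc? e′ (lower K e) ⊎-dec inc? e′ (upper K e)

  touch⁺ : ∀ {e e′ σ} → Inc e σ → Inc e′ σ → Touch e e′
  touch⁺ (inj₁ refl) inc = inj₁ inc
  touch⁺ (inj₂ refl) inc = inj₂ inc

  touch⁻ : ∀ {e e′} → Touch e e′ → ∃[ σ ] Inc e σ × Inc e′ σ
  touch⁻ (inj₁ inc) = _ , inj₁ refl , inc
  touch⁻ (inj₂ inc) = _ , inj₂ refl , inc

  inc⇒~ : ∀ {e σ τ} → Inc e σ → Inc e τ → σ ≢ τ → σ ~ τ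
  inc⇒~ {e} (inj₁ refl) (inj₂ refl) _   = inj₁ (primitivePair-≺ K e)
  inc⇒~ {e} (inj₂ refl) (inj₁ refl) _   = inj₂ (primitivePair-≺ K e)
  inc⇒~     (inj₁ refl) (inj₁ refl) σ≢σ = contradiction refl σ≢σ
  inc⇒~     (inj₂ refl) (inj₂ refl) σ≢σ = contradiction refl σ≢σ

  inc-endpoints : ∀ {e σ τ ρ} → Inc e σ → Inc e τ → σ ≢ τ → Inc e ρ → ρ ≡ σ ⊎ ρ ≡ τ
  inc-endpoints (inj₁ refl) (inj₁ refl) σ≢σ _           = contradiction refl σ≢σ
  inc-endpoints (inj₂ refl) (inj₂ refl) σ≢σ _           = contradiction refl σ≢σ
  inc-endpoints (inj₁ refl) (inj₂ refl) _   (inj₁ refl) = inj₁ refl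
  inc-endpoints (inj₁ refl) (inj₂ refl) _   (inj₂ refl) = inj₂ refl
  inc-endpoints (inj₂ refl) (inj₁ refl) _   (inj₁ refl) = inj₂ refl
  inc-endpoints (inj₂ refl) (inj₁ refl) _   (inj₂ refl) = inj₁ refl

  inc-≺ : ∀ {e σ τ} → Inc e σ → Inc e τ → σ ≺ τ → lower K e ≡ σ × upper K e ≡ τ
  inc-≺     (inj₁ refl) (inj₁ refl) σ≺τ = contradiction σ≺τ (≺-asym σ≺τ)
  inc-≺     (inj₂ refl) (inj₂ refl) σ≺τ = contradiction σ≺τ (≺-asym σ≺τ)
  inc-≺     (inj₁ refl) (inj₂ refl) _   = refl , refl
  inc-≺ {e} (inj₂ refl) (inj₁ refl) σ≺τ = contradiction σ≺τ (≺-asym (primitivePair-≺ K e))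

  inc-unique : ∀ {e e′ σ τ} → Inc e σ → Inc e τ → Inc e′ σ → Inc e′ τ → σ ≢ τ → e ≡ e′
  inc-unique {e} {e′} i j i′ j′ σ≢τ = [ (λ σ≺τ → go i j i′ j′ σ≺τ) , (λ τ≺σ → go j i j′ i′ τ≺σ) ]′ (inc⇒~ i j σ≢τ)
    where
    go : ∀ {σ τ} → Inc e σ → Inc e τ → Inc e′ σ → Inc e′ τ → σ ≺ τ → e ≡ e′
    go i j i′ j′ σ≺τ with inc-≺ i j σ≺τ | inc-≺ i′ j′ σ≺τ
    ... | l , u | l′ , u′ = primitivePair-injective K (cong₂ _,_ (trans l (sym l′)) (trans u (sym u′)))

  other-endpoint : ∀ {e σ} → Inc e σ → ∃[ τ ] Inc e τ × τ ≢ σ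
  other-endpoint {e} (inj₁ refl) = upper K e , inj₂ refl , ≢-sym (≺⇒≢ (primitivePair-≺ K e))
  other-endpoint {e} (inj₂ refl) = lower K e , inj₁ refl , ≺⇒≢ (primitivePair-≺ K e)

  primitive-inc : ∀ {σ τ} → σ ≺ τ → ∃[ e ] Inc e σ × Inc e τ
  primitive-inc σ≺τ = let e , eq = primitivePair-surjective K σ≺τ in
    e , inj₁ (cong proj₁ eq) , inj₂ (cong proj₂ eq)

  ~-odd : ∀ {σ τ : Simplex K} → σ ~ τ → odd (dim τ) ≡ not (odd (dim σ))
  ~-odd (inj₁ σ≺τ) = cong odd (≺-dim σ≺τ)
  ~-odd (inj₂ τ≺σ) = trans (sym (not-involutive _)) (cong not (sym (cong odd (≺-dim τ≺σ))))

  triangle-free : ∀ {a b c : Simplex K} → a ~ b → b ~ c → ¬ a ~ c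
  triangle-free ab bc ac = not-¬ refl (trans (sym (not-involutive _))
    (trans (cong not (sym (~-odd ab))) (trans (sym (~-odd bc)) (~-odd ac))))

  -- If `e″` avoided `σ`, its common ends `x` and `y` with `e` and `e′` would form a triangle with
  -- `σ`. This rules out the triangle that Whitney's theorem confuses with a claw.
  clique⇒star : ∀ {e e′ e″ σ} → e ≢ e′ → Inc e σ → Inc e′ σ → Touch e″ e → Touch e″ e′ → Inc e″ σ
  clique⇒star {e} {e′} {e″} {σ} e≢e′ i i′ t t′ with touch⁻ t | touch⁻ t′
  ... | x , i₁ , i₂ | y , j₁ , j₂ with x ≟ₛ σ | y ≟ₛ σ
  ...   | yes refl | _ = i₁
  ...   | _ | yes refl = j₁
  ...   | no x≢σ | no y≢σ = contradiction (inc⇒~ i′ j₂ (≢-sym y≢σ)) (triangle-free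
    (inc⇒~ i i₂ (≢-sym x≢σ)) (inc⇒~ i₁ j₁ λ { refl → e≢e′ (inc-unique i i₂ i′ j₂ (≢-sym x≢σ)) }))

  touching⇒¬face : ∀ {e e′} → e ≢ e′ → Touch e e′ → ¬ MorseFace K (⁅ e ⁆ ∪ ⁅ e′ ⁆)
  touching⇒¬face {e} {e′} e≢e′ t M = e≢e′ (go t)
    where
    m = proj₁ (proj₂ (Equivalence.to (morseFace⇔ K (⁅ e ⁆ ∪ ⁅ e′ ⁆)) M))
    go : Touch e e′ → e ≡ e′
    go (inj₁ (inj₁ eq)) = m e e′ (∈-pairˡ e e′) (∈-pairʳ e e′) (inj₁ (sym eq))
    go (inj₁ (inj₂ eq)) = sym (m e′ e (∈-pairʳ e e′) (∈-pairˡ e e′) (inj₂ (inj₂ eq)))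
    go (inj₂ (inj₁ eq)) = m e e′ (∈-pairˡ e e′) (∈-pairʳ e e′) (inj₂ (inj₂ (sym eq)))
    go (inj₂ (inj₂ eq)) = m e e′ (∈-pairˡ e e′) (∈-pairʳ e e′) (inj₂ (inj₁ (sym eq)))

  private
    -- No V-step leads from i to j, so j may be given the higher potential.
    acyclic-pair : ∀ {s} i j → (∀ {e} → e ∈ s → e ≡ i ⊎ e ≡ j) → lower K i ≢ lower K j →
                   ¬ lower K j ≺ upper K i → Acyclic K s
    acyclic-pair {s} i j mem i≢j j⊀i = record
      { potential  = λ σ → pot (lower K j ≟ₛ σ) (lower K i ≟ₛ σ)
      ; bound      = 3
      ; bounded    = λ σ → bounded (lower K j ≟ₛ σ) (lower K i ≟ₛ σ)
      ; decreasing = decr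
      }
      where
      pot : ∀ {σ} → Dec (lower K j ≡ σ) → Dec (lower K i ≡ σ) → ℕ
      pot (yes _) _       = 2
      pot (no _)  (yes _) = 1
      pot (no _)  (no _)  = 0

      bounded : ∀ {σ} (d : Dec (lower K j ≡ σ)) (d′ : Dec (lower K i ≡ σ)) → pot d d′ ℕ.< 3
      bounded (yes _) _       = s≤s (s≤s (s≤s z≤n))
      bounded (no _)  (yes _) = s≤s (s≤s z≤n)
      bounded (no _)  (no _)  = s≤s z≤n

      pot-< : ∀ {η ν} (d : Dec (lower K j ≡ η)) (d′ : Dec (lower K i ≡ η))
              (c : Dec (lower K j ≡ ν)) (c′ : Dec (lower K i ≡ ν)) →
              ∀ {m} → m ≡ i ⊎ m ≡ j → lower K m ≡ η → ν ≺ upper K m → ν ≢ η → pot c c′ ℕ.< pot d d′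
      pot-< _       _        (yes refl) _          (inj₁ refl) _    ν≺ _   = contradiction ν≺ j⊀i
      pot-< _       _        (no _)     (yes refl) (inj₁ refl) refl _  ν≢η = contradiction refl ν≢η
      pot-< (yes eq) _       (no _)     (no _)     (inj₁ refl) refl _  _   = s≤s z≤n
      pot-< (no _)  (yes _)  (no _)     (no _)     (inj₁ refl) refl _  _   = s≤s z≤n
      pot-< (no _)  (no i≢i) (no _)     (no _)     (inj₁ refl) refl _  _   = contradiction refl i≢i
      pot-< _       _        (yes refl) _          (inj₂ refl) refl _  ν≢η = contradiction refl ν≢η
      pot-< (no j≢j) _       (no _)     _          (inj₂ refl) refl _  _   = contradiction refl j≢j
      pot-< (yes _) _        (no _)     (yes _)    (inj₂ refl) refl _  _   = s≤s (s≤s z≤n)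
      pot-< (yes _) _        (no _)     (no _)     (inj₂ refl) refl _  _   = s≤s z≤n

      decr : ∀ {η ν} → VStep K s η ν →
             pot (lower K j ≟ₛ ν) (lower K i ≟ₛ ν) ℕ.< pot (lower K j ≟ₛ η) (lower K i ≟ₛ η)
      decr {η} {ν} (m , m∈ , l≡ , ν≺ , ν≢η) =
        pot-< (lower K j ≟ₛ η) (lower K i ≟ₛ η) (lower K j ≟ₛ ν) (lower K i ≟ₛ ν) (mem m∈) l≡ ν≺ ν≢η

  -- A closed V-path would alternate between the two lower simplices, making each a face of both
  -- upper ones; then the upper ones coincide. So V-steps lead at most one way, and the pairs are
  -- ordered accordingly.
  disjoint⇒face : ∀ {e e′} → ¬ Touch e e′ → MorseFace K (⁅ e ⁆ ∪ ⁅ e′ ⁆)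
  disjoint⇒face {e} {e′} ¬t = Equivalence.from (morseFace⇔ K (⁅ e ⁆ ∪ ⁅ e′ ⁆)) ((e , ∈-pairˡ e e′) , mat , acyc)
    where
    mat : Matching K (⁅ e ⁆ ∪ ⁅ e′ ⁆)
    mat i j i∈ j∈ m with ∈-pair⁻ i∈ | ∈-pair⁻ j∈
    ... | inj₁ refl | inj₁ refl = refl
    ... | inj₂ refl | inj₂ refl = refl
    ... | inj₁ refl | inj₂ refl = contradiction
      ([ (λ eq → inj₁ (inj₁ (sym eq))) , [ (λ eq → inj₂ (inj₂ (sym eq))) , (λ eq → inj₂ (inj₁ (sym eq))) ]′ ]′ m) ¬t
    ... | inj₂ refl | inj₁ refl = contradiction
      ([ (λ eq → inj₁ (inj₁ eq)) , [ (λ eq → inj₂ (inj₂ eq)) , (λ eq → inj₁ (inj₂ eq)) ]′ ]′ m) ¬t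
    l≢l : lower K e ≢ lower K e′
    l≢l eq = ¬t (inj₁ (inj₁ (sym eq)))
    acyc : Acyclic K (⁅ e ⁆ ∪ ⁅ e′ ⁆)
    acyc with lower K e′ ≺? upper K e
    ... | no  e′⊀e = acyclic-pair e e′ ∈-pair⁻ l≢l e′⊀e
    ... | yes e′≺e = acyclic-pair e′ e (swap ∘ ∈-pair⁻) (≢-sym l≢l) λ e≺e′ → ¬t (inj₂ (inj₂
      (coface-determined (primitivePair-≺ K e′) e≺e′ (≢-sym l≢l) e′≺e (primitivePair-≺ K e))))

-- From `𝔐` to the line graph, and from the line graph to the Hasse diagram.

record LineIso (K : SimplicialComplex k) (L : SimplicialComplex ℓ) : Set (k ⊔ ℓ) where
  field
    φ       : Fin (#primitives K) → Fin (#primitives L)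
    ψ       : Fin (#primitives L) → Fin (#primitives K)
    ψ∘φ     : ∀ e → ψ (φ e) ≡ e
    φ∘ψ     : ∀ e → φ (ψ e) ≡ e
    φ-touch : ∀ {e e′} → Touch K e e′ → Touch L (φ e) (φ e′)
    ψ-touch : ∀ {e e′} → Touch L e e′ → Touch K (ψ e) (ψ e′)

  φ-injective : ∀ {e e′} → φ e ≡ φ e′ → e ≡ e′
  φ-injective eq = trans (sym (ψ∘φ _)) (trans (cong ψ eq) (ψ∘φ _))

  φ-touch⁻ : ∀ {e e′} → Touch L (φ e) (φ e′) → Touch K e e′
  φ-touch⁻ t = subst₂ (Touch K) (ψ∘φ _) (ψ∘φ _) (ψ-touch t)

lineSym : ∀ {K : SimplicialComplex k} {L : SimplicialComplex ℓ} → LineIso K L → LineIso L K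
lineSym I = record { φ = ψ ; ψ = φ ; ψ∘φ = φ∘ψ ; φ∘ψ = ψ∘φ ; φ-touch = ψ-touch ; ψ-touch = φ-touch }
  where open LineIso I

≅⇒lineIso : ∀ {K : SimplicialComplex k} {L : SimplicialComplex ℓ} → 𝔐 K ≅ 𝔐 L → LineIso K L
≅⇒lineIso {K = K} {L} I = record
  { φ = to ; ψ = from ; ψ∘φ = strictlyInverseʳ ; φ∘ψ = strictlyInverseˡ
  ; φ-touch = fwd
  ; ψ-touch = λ t → bwd (subst₂ (Touch L) (sym (strictlyInverseˡ _)) (sym (strictlyInverseˡ _)) t)
  }
  where
  open _≅_ I
  open Inverse vertices↔
  to-inj : ∀ {e e′} → to e ≡ to e′ → e ≡ e′
  to-inj eq = trans (sym (strictlyInverseʳ _)) (trans (cong from eq) (strictlyInverseʳ _))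
  fwd : ∀ {e e′} → Touch K e e′ → Touch L (to e) (to e′)
  fwd {e} {e′} t with e Finₚ.≟ e′
  -- The diagonal is separate: an edge touches itself although the singleton it spans is a face of
  -- `𝔐 K`.
  ... | yes refl = inj₁ (inj₁ refl)
  ... | no e≢e′ = decidable-stable (touch? L (to e) (to e′)) λ ¬t → touching⇒¬face K e≢e′ t
    (Equivalence.from (face⇔ _) (subst (MorseFace L) (sym (image-pair vertices↔ e e′)) (disjoint⇒face L ¬t)))
  bwd : ∀ {e e′} → Touch L (to e) (to e′) → Touch K e e′
  bwd {e} {e′} t with e Finₚ.≟ e′
  ... | yes refl = inj₁ (inj₁ refl)
  ... | no e≢e′ = decidable-stable (touch? K e e′) λ ¬t → touching⇒¬face L (e≢e′ ∘ to-inj) t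
    (subst (MorseFace L) (image-pair vertices↔ e e′) (Equivalence.to (face⇔ _) (disjoint⇒face K ¬t)))

-- Whitney's line graph theorem for Hasse diagrams: being triangle free,
-- they have no line graph isomorphisms other than the induced ones.
module Whitney {K : SimplicialComplex k} {L : SimplicialComplex ℓ} (I : LineIso K L)
               (cofaceK : ∀ v → ∃[ τ ] ⟦_⟧ {K = K} v ≺ τ) where
  open LineIso I

  record SameStar (σ : Simplex K) (ρ : Simplex L) : Set (k ⊔ ℓ) where
    field
      fwd : ∀ {e} → Inc K e σ → Inc L (φ e) ρ
      bwd : ∀ {e} → Inc L (φ e) ρ → Inc K e σ
  open SameStar public

  -- Two faces of `τ` give two distinct edges at `τ`, whose images meet in some `ρ`. Every further
  -- edge at `τ` touches both, so `clique⇒star` puts its image at `ρ`, and likewise backwards.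
  upper-star : ∀ {σ τ} → σ ≺ τ → ∃ (SameStar τ)
  upper-star {σ} {τ} σ≺τ with another-face σ≺τ
  ... | σ′ , σ′≺τ , σ′≢σ with primitive-inc K σ≺τ | primitive-inc K σ′≺τ
  ...   | e , eσ , eτ | e′ , eσ′ , e′τ with touch⁻ L (φ-touch (touch⁺ K eτ e′τ))
  ...     | ρ , i , i′ = ρ , record
    { fwd = λ j → clique⇒star L (e≢e′ ∘ φ-injective) i i′ (φ-touch (touch⁺ K j eτ)) (φ-touch (touch⁺ K j e′τ))
    ; bwd = λ j → clique⇒star K e≢e′ eτ e′τ (φ-touch⁻ (touch⁺ L j i)) (φ-touch⁻ (touch⁺ L j i′)) }
    where
    e≢e′ : e ≢ e′
    e≢e′ refl = σ′≢σ (trans (sym (proj₁ (inc-≺ K eσ′ e′τ σ′≺τ))) (proj₁ (inc-≺ K eσ eτ σ≺τ)))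

  -- The star of `σ` may be a single edge, with no second one to intersect. Its image is therefore
  -- taken as the end of `φ e` other than the known image of `τ`.
  lower-star : ∀ {σ τ} → σ ≺ τ → ∃ (SameStar σ)
  lower-star {σ} {τ} σ≺τ with upper-star σ≺τ | primitive-inc K σ≺τ
  ... | τ′ , S | e , eσ , eτ with other-endpoint L (fwd S eτ)
  ...   | ρ , eρ , ρ≢τ′ = ρ , record { fwd = fwd′ ; bwd = bwd′ }
    where
    fwd′ : ∀ {e′} → Inc K e′ σ → Inc L (φ e′) ρ
    fwd′ {e′} j with touch⁻ L (φ-touch (touch⁺ K j eσ))
    ... | x , jx , ex with inc-endpoints L eρ (fwd S eτ) ρ≢τ′ ex
    ...   | inj₁ refl = jx
    ...   | inj₂ refl = subst (λ e → Inc L (φ e) ρ) (inc-unique K eσ eτ j (bwd S jx) (≺⇒≢ σ≺τ)) eρ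
    bwd′ : ∀ {e′} → Inc L (φ e′) ρ → Inc K e′ σ
    bwd′ {e′} j with touch⁻ K (φ-touch⁻ (touch⁺ L j eρ))
    ... | x , jx , ex with inc-endpoints K eσ eτ (≺⇒≢ σ≺τ) ex
    ...   | inj₁ refl = jx
    ...   | inj₂ refl = subst (λ e → Inc K e σ)
      (φ-injective (inc-unique L eρ (fwd S eτ) j (fwd S jx) ρ≢τ′)) eσ

  neighbour : ∀ σ → (∃[ τ ] τ ≺ σ) ⊎ (∃[ τ ] σ ≺ τ)
  neighbour σ = go (dim σ) refl
    where
    go : ∀ d → dim σ ≡ d → (∃[ τ ] τ ≺ σ) ⊎ (∃[ τ ] σ ≺ τ)
    go zero    eq with dim≡0⇒∃ σ eq
    ... | v , refl = inj₂ (cofaceK v)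
    go (suc d) eq = inj₁ (∃-face eq)

  same-star : ∀ σ → ∃ (SameStar σ)
  same-star σ with neighbour σ
  ... | inj₁ (_ , τ≺σ) = upper-star τ≺σ
  ... | inj₂ (_ , σ≺τ) = lower-star σ≺τ

  incident : ∀ σ → ∃[ e ] Inc K e σ
  incident σ with neighbour σ
  ... | inj₁ (_ , τ≺σ) = let e , _ , i = primitive-inc K τ≺σ in e , i
  ... | inj₂ (_ , σ≺τ) = let e , i , _ = primitive-inc K σ≺τ in e , i

  -- Two distinct candidates would be joined by the image of an edge at `σ`; the larger has another
  -- face, hence an edge that misses the smaller.
  same-star-unique : ∀ {σ ρ ρ′} → SameStar σ ρ → SameStar σ ρ′ → ρ ≡ ρ′
  same-star-unique {σ} {ρ} {ρ′} S S′ = decidable-stable (ρ ≟ₛ ρ′) λ ρ≢ρ′ →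
    let e , i = incident σ in [ clash S S′ , clash S′ S ]′ (inc⇒~ L (fwd S i) (fwd S′ i) ρ≢ρ′)
    where
    clash : ∀ {ρ ρ′} → SameStar σ ρ → SameStar σ ρ′ → ¬ ρ ≺ ρ′
    clash {ρ} {ρ′} S S′ ρ≺ρ′ with another-face ρ≺ρ′
    ... | ρ″ , ρ″≺ρ′ , ρ″≢ρ with primitive-inc L ρ″≺ρ′
    ...   | e , i , j with inc-endpoints L i j (≺⇒≢ ρ″≺ρ′)
        (subst (λ e → Inc L e ρ) (φ∘ψ e) (fwd S (bwd S′ (subst (λ e → Inc L e ρ′) (sym (φ∘ψ e)) j))))
    ...     | inj₁ ρ≡ρ″ = ρ″≢ρ (sym ρ≡ρ″)
    ...     | inj₂ ρ≡ρ′ = ≺⇒≢ ρ≺ρ′ ρ≡ρ′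

module _ {K : SimplicialComplex k} {L : SimplicialComplex ℓ} (I : LineIso K L)
         (cofaceK : ∀ v → ∃[ τ ] ⟦_⟧ {K = K} v ≺ τ) (cofaceL : ∀ v → ∃[ τ ] ⟦_⟧ {K = L} v ≺ τ) where

  private
    module W = Whitney I cofaceK
    module W′ = Whitney (lineSym I) cofaceL
    open LineIso I

    transpose : ∀ {σ ρ} → W.SameStar σ ρ → W′.SameStar ρ σ
    transpose {σ} {ρ} S = record
      { fwd = λ {e} i → W.bwd S (subst (λ e → Inc L e ρ) (sym (φ∘ψ e)) i)
      ; bwd = λ {e} i → subst (λ e → Inc L e ρ) (φ∘ψ e) (W.fwd S i) }

    transpose′ : ∀ {σ ρ} → W′.SameStar ρ σ → W.SameStar σ ρ
    transpose′ {σ} {ρ} S = record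
      { fwd = λ {e} i → W′.bwd S (subst (λ e → Inc K e σ) (sym (ψ∘φ e)) i)
      ; bwd = λ {e} i → subst (λ e → Inc K e σ) (ψ∘φ e) (W′.fwd S i) }

    f : Simplex K → Simplex L
    f σ = proj₁ (W.same-star σ)
    g : Simplex L → Simplex K
    g ρ = proj₁ (W′.same-star ρ)
    g∘f : ∀ σ → g (f σ) ≡ σ
    g∘f σ = W′.same-star-unique (proj₂ (W′.same-star (f σ))) (transpose (proj₂ (W.same-star σ)))
    f∘g : ∀ ρ → f (g ρ) ≡ ρ
    f∘g ρ = W.same-star-unique (proj₂ (W.same-star (g ρ))) (transpose′ (proj₂ (W′.same-star ρ)))

  lineIso⇒hasseIso : HasseIso K L
  lineIso⇒hasseIso = record
    { to = f ; from = g ; from∘to = g∘f ; to∘from = f∘g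
    ; to-≺ = λ {σ} {τ} σ≺τ → let e , i , j = primitive-inc K σ≺τ in
        inc⇒~ L (W.fwd (proj₂ (W.same-star σ)) i) (W.fwd (proj₂ (W.same-star τ)) j)
          λ eq → ≺⇒≢ σ≺τ (trans (sym (g∘f σ)) (trans (cong g eq) (g∘f τ)))
    ; from-≺ = λ {σ} {τ} σ≺τ → let e , i , j = primitive-inc L σ≺τ in
        inc⇒~ K (W′.fwd (proj₂ (W′.same-star σ)) i) (W′.fwd (proj₂ (W′.same-star τ)) j)
          λ eq → ≺⇒≢ σ≺τ (trans (sym (f∘g σ)) (trans (cong f eq) (f∘g τ)))
    }

-- Order-reversing isomorphisms: boundaries of simplices.

module OrderReversing {K : SimplicialComplex k} {L : SimplicialComplex ℓ} (F : HasseIso K L)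
                      (anti : ∀ {σ τ} → σ ≺ τ → HasseIso.to F τ ≺ HasseIso.to F σ) where
  open HasseIso F

  from-anti : ∀ {σ τ} → σ ≺ τ → from τ ≺ from σ
  from-anti {σ} {τ} σ≺τ with from-≺ σ≺τ
  ... | inj₁ up   = contradiction (subst₂ _≺_ (to∘from τ) (to∘from σ) (anti up)) (≺-asym σ≺τ)
  ... | inj₂ down = down

  to-⊇ : ∀ {σ τ} → vertices σ ⊆ vertices τ → vertices (to τ) ⊆ vertices (to σ)
  to-⊇ σ⊆τ = go (⊆⇒≺* σ⊆τ)
    where
    go : ∀ {σ τ} → Star _≺_ σ τ → vertices (to τ) ⊆ vertices (to σ)
    go ε x∈ = x∈
    go (σ≺ρ ◅ ρ≺*τ) x∈ = ≺⇒⊆ (anti σ≺ρ) (go ρ≺*τ x∈)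

  to≺⇒from≺ : ∀ {σ ρ} → to σ ≺ ρ → from ρ ≺ σ
  to≺⇒from≺ to≺ = subst (from _ ≺_) (from∘to _) (from-anti to≺)

  ≺to⇒≺from : ∀ {σ ρ} → ρ ≺ to σ → σ ≺ from ρ
  ≺to⇒≺from ≺to = subst (_≺ from _) (from∘to _) (from-anti ≺to)

  ≺from⇒≺to : ∀ {σ ρ} → σ ≺ from ρ → ρ ≺ to σ
  ≺from⇒≺to ≺from = subst (_≺ to _) (to∘from _) (anti ≺from)

  covered : ∀ ρ → ∃[ v ] vertices ρ ⊆ vertices (to ⟦ v ⟧)
  covered ρ = let v , v∈ = simplex-nonempty (from ρ) in
    v , λ x∈ → to-⊇ {⟦ v ⟧} {from ρ} (∈⇒⟦⟧⊆ {K = K} v∈) (subst (λ ρ → _ ∈ vertices ρ) (sym (to∘from ρ)) x∈)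

-- Reversing such a flag shows that the dual of `v` has dimension at least 2; so high dimension
-- passes between `K` and `L`.
low-flag : ∀ {K : SimplicialComplex k} d {τ : Simplex K} → dim τ ≡ suc (suc d) →
           Σ (Fin (#vertices K)) λ v → Σ (Simplex K) λ a → Σ (Simplex K) λ b → ⟦ v ⟧ ≺ a × a ≺ b
low-flag zero {τ} dτ with ∃-face {τ = τ} dτ
... | a , a≺τ with ∃-face {τ = a} (ℕₚ.suc-injective (trans (sym (≺-dim a≺τ)) dτ))
...   | ρ , ρ≺a with dim≡0⇒∃ ρ (ℕₚ.suc-injective (ℕₚ.suc-injective
  (trans (sym (trans (≺-dim a≺τ) (cong suc (≺-dim ρ≺a)))) dτ)))
...     | v , refl = v , a , τ , ρ≺a , a≺τ
low-flag (suc d) {τ} dτ with ∃-face {τ = τ} dτ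
... | a , a≺τ = low-flag d {a} (ℕₚ.suc-injective (trans (sym (≺-dim a≺τ)) dτ))

module Boundary {K : SimplicialComplex k} {L : SimplicialComplex ℓ} (conn : ∀ u v → Star (Adjacent K) u v)
                (F : HasseIso K L) (anti : ∀ {σ τ} → σ ≺ τ → HasseIso.to F τ ≺ HasseIso.to F σ)
                (v₀ : Fin (#vertices K)) {d : ℕ} (dτ : dim (HasseIso.to F ⟦ v₀ ⟧) ≡ suc (suc d)) where
  open HasseIso F
  open OrderReversing F anti

  τ : Simplex L
  τ = to ⟦ v₀ ⟧

  ridge-dim : ∀ {r} → r ≺ τ → dim r ≡ suc d
  ridge-dim r≺τ = ℕₚ.suc-injective (trans (sym (≺-dim r≺τ)) dτ)

  -- The ridge `r` is dual to an edge at `v₀`, and the other end of that edge is dual to the facet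
  -- across `r`.
  across : ∀ {r} → r ≺ τ → ∃[ ρ ] r ≺ ρ × ρ ≢ τ
  across {r} r≺τ with another-face (≺to⇒≺from r≺τ)
  ... | x , x≺ , x≢ = to x , ≺from⇒≺to x≺ , x≢ ∘ to-injective

  new-vertex : ∀ {r ρ w} → r ≺ τ → r ≺ ρ → ρ ≢ τ → Missing r ρ w → w ∉ vertices τ
  new-vertex {r} {ρ} {w} r≺τ r≺ρ ρ≢τ m w∈τ = ρ≢τ (⊆∧dim≡⇒≡ ρ⊆τ (trans (≺-dim r≺ρ) (sym (≺-dim r≺τ))))
    where
    ρ⊆τ : vertices ρ ⊆ vertices τ
    ρ⊆τ {z} z∈ with z Finₚ.≟ w
    ... | yes refl = w∈τ
    ... | no  z≢w  = ≺⇒⊆ r≺τ (cover m z∈ z≢w)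

  -- The edges of K dual to the ridges r and r′ span a triangle; the third
  -- edge is dual to a common ridge of the facets ρ and ρ′.
  common-ridge : ∀ {r r′ ρ ρ′} → r ≺ τ → r′ ≺ τ → r ≢ r′ → r ≺ ρ → ρ ≢ τ → r′ ≺ ρ′ → ρ′ ≢ τ →
                 ∃[ q ] q ≺ ρ × q ≺ ρ′
  common-ridge {r} {r′} {ρ} {ρ′} r≺τ r′≺τ r≢r′ r≺ρ ρ≢τ r′≺ρ′ ρ′≢τ
    with meet (ridge-dim r≺τ) r≺τ r′≺τ r≢r′
  ... | u , u≺r , u≺r′ with diamond K (from-anti r≺ρ) (from-anti u≺r)
  ...   | e , x≺e , e≺t , r≢e with meet de e≺t (from-anti u≺r′) e≢r′
    where
    de : dim e ≡ 1
    de = trans (≺-dim x≺e) (cong suc (trans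
      (ℕₚ.suc-injective (trans (sym (≺-dim (from-anti r≺ρ))) (≺-dim (≺to⇒≺from r≺τ)))) (dim-⟦⟧ {K = K} v₀)))
    e≢r′ : e ≢ from r′
    e≢r′ refl = r≢r′ (trans (sym (to∘from r)) (trans (cong to (coface-determined (from-anti r≺ρ) (≺to⇒≺from r≺τ)
      (λ eq → ρ≢τ (trans (sym (to∘from ρ)) (cong to eq))) x≺e (≺to⇒≺from r′≺τ))) (to∘from r′)))
  ...     | y , y≺e , y≺r′ with edge-faces (dim-⟦⟧ {K = K} v₀) (≺to⇒≺from r′≺τ) (from-anti r′≺ρ′)
      (λ eq → ρ′≢τ (trans (sym (to∘from ρ′)) (cong to (sym eq)))) y≺r′
  ...       | inj₁ refl = contradiction (coface-determined (from-anti r≺ρ) (≺to⇒≺from r≺τ)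
      (λ eq → ρ≢τ (trans (sym (to∘from ρ)) (cong to eq))) x≺e y≺e) r≢e
  ...       | inj₂ refl = to e , subst (to e ≺_) (to∘from ρ) (anti x≺e) , subst (to e ≺_) (to∘from ρ′) (anti y≺e)

  -- With distinct new vertices, `ρ` and `ρ′` would share only the intersection `u` of `r` and `r′`,
  -- which is one dimension too small to contain their common ridge `q`.
  same-new-vertex : ∀ {r r′ ρ ρ′ w w′} → r ≺ τ → r′ ≺ τ → r ≢ r′ → r ≺ ρ → ρ ≢ τ → r′ ≺ ρ′ → ρ′ ≢ τ →
                    Missing r ρ w → Missing r′ ρ′ w′ → w ≡ w′
  same-new-vertex {r} {r′} {ρ} {ρ′} {w} {w′} r≺τ r′≺τ r≢r′ r≺ρ ρ≢τ r′≺ρ′ ρ′≢τ m m′ =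
    decidable-stable (w Finₚ.≟ w′) λ w≢w′ → go w≢w′ (meet (ridge-dim r≺τ) r≺τ r′≺τ r≢r′)
      (common-ridge r≺τ r′≺τ r≢r′ r≺ρ ρ≢τ r′≺ρ′ ρ′≢τ)
    where
    go : w ≢ w′ → ∃[ u ] u ≺ r × u ≺ r′ → ¬ (∃[ q ] q ≺ ρ × q ≺ ρ′)
    go w≢w′ (u , u≺r , u≺r′) (q , q≺ρ , q≺ρ′) with missing u≺r
    ... | b , mb = ℕₚ.m≢1+n+m (dim u) {0} (trans (sym (cong dim q≡u)) (trans dq (≺-dim u≺r)))
      where
      dq : dim q ≡ dim r
      dq = ℕₚ.suc-injective (trans (sym (≺-dim q≺ρ)) (≺-dim r≺ρ))
      b∉r′ : b ∉ vertices r′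
      b∉r′ b∈r′ = r≢r′ (⊆∧dim≡⇒≡ r⊆r′ (trans (≺-dim u≺r) (sym (≺-dim u≺r′))))
        where
        r⊆r′ : vertices r ⊆ vertices r′
        r⊆r′ {z} z∈ with z Finₚ.≟ b
        ... | yes refl = b∈r′
        ... | no  z≢b  = ≺⇒⊆ u≺r′ (cover mb z∈ z≢b)
      q∈r : ∀ {z} → z ∈ vertices q → z ∈ vertices r
      q∈r z∈q = cover m (≺⇒⊆ q≺ρ z∈q) λ { refl →
        new-vertex r≺τ r≺ρ ρ≢τ m (≺⇒⊆ r′≺τ (cover m′ (≺⇒⊆ q≺ρ′ z∈q) w≢w′)) }
      q∈r′ : ∀ {z} → z ∈ vertices q → z ∈ vertices r′
      q∈r′ z∈q = cover m′ (≺⇒⊆ q≺ρ′ z∈q) λ { refl →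
        new-vertex r′≺τ r′≺ρ′ ρ′≢τ m′ (≺⇒⊆ r≺τ (cover m (≺⇒⊆ q≺ρ z∈q) (≢-sym w≢w′))) }
      q⊆u : vertices q ⊆ vertices u
      q⊆u z∈q = cover mb (q∈r z∈q) λ { refl → b∉r′ (q∈r′ z∈q) }
      q≡u : q ≡ u
      q≡u = simplex-≡ (⊆-antisym q⊆u (⊆-of q⊆u))
        where
        ⊆-of : vertices q ⊆ vertices u → vertices u ⊆ vertices q
        ⊆-of q⊆u = contradiction (p⊆q⇒∣p∣≤∣q∣ q⊆u) (ℕₚ.<⇒≱ (ℕₚ.≤-reflexive (trans
          (cong suc (trans (∣vertices∣ u) (sym (≺-dim u≺r)))) (sym (trans (∣vertices∣ q) (cong suc dq))))))

  module Facets {r₀ ρ₀ w} (r₀≺τ : r₀ ≺ τ) (r₀≺ρ₀ : r₀ ≺ ρ₀) (ρ₀≢τ : ρ₀ ≢ τ) (mw : Missing r₀ ρ₀ w) where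

    -- Every facet dual to a vertex of K will turn out to be τ ∪ {w} minus a point.
    T : Fin (#vertices L) → Set
    T z = z ∈ vertices τ ⊎ z ≡ w

    record AllBut (y : Fin (#vertices L)) (ρ : Simplex L) : Set where
      field
        dim≡  : dim ρ ≡ dim τ
        ⊆T    : ∀ {z} → z ∈ vertices ρ → T z
        y∉    : y ∉ vertices ρ
        cover : ∀ {z} → T z → z ≢ y → z ∈ vertices ρ
    open AllBut

    allBut-unique : ∀ {y ρ ρ′} → AllBut y ρ → AllBut y ρ′ → ρ ≡ ρ′
    allBut-unique A B = ⊆∧dim≡⇒≡
      (λ z∈ → cover B (⊆T A z∈) λ { refl → y∉ A z∈ }) (trans (dim≡ A) (sym (dim≡ B)))

    w∉τ : w ∉ vertices τ
    w∉τ = new-vertex r₀≺τ r₀≺ρ₀ ρ₀≢τ mw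

    allBut-w : AllBut w τ
    allBut-w = record { dim≡ = refl ; ⊆T = inj₁ ; y∉ = w∉τ ; cover = cov }
      where
      cov : ∀ {z} → T z → z ≢ w → z ∈ vertices τ
      cov (inj₁ z∈) _ = z∈
      cov (inj₂ z≡w) z≢w = contradiction z≡w z≢w

    allBut-∈τ : ∀ {r ρ y} → r ≺ τ → Missing r τ y → r ≺ ρ → Missing r ρ w → AllBut y ρ
    allBut-∈τ {r} {ρ} {y} r≺τ my r≺ρ m = record
      { dim≡ = trans (≺-dim r≺ρ) (sym (≺-dim r≺τ)) ; ⊆T = sub
      ; y∉ = λ y∈ → ∉σ my (Missing.cover m y∈ λ { refl → w∉τ (∈τ my) }) ; cover = cov }
      where
      sub : ∀ {z} → z ∈ vertices ρ → T z
      sub {z} z∈ with z Finₚ.≟ w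
      ... | yes z≡w = inj₂ z≡w
      ... | no  z≢w = inj₁ (≺⇒⊆ r≺τ (Missing.cover m z∈ z≢w))
      cov : ∀ {z} → T z → z ≢ y → z ∈ vertices ρ
      cov (inj₁ z∈τ)  z≢y = ≺⇒⊆ r≺ρ (Missing.cover my z∈τ z≢y)
      cov (inj₂ refl) _   = ∈τ m

    allBut-opposite : ∀ {r y} → r ≺ τ → Missing r τ y → ∃ (AllBut y)
    -- `same-new-vertex` compares distinct ridges; across `r₀` itself the facet `ρ₀` is already
    -- known.
    allBut-opposite {r} r≺τ my with r ≟ₛ r₀ | across r≺τ
    ... | yes refl | _ = ρ₀ , allBut-∈τ r≺τ my r₀≺ρ₀ mw
    ... | no r≢r₀ | ρ , r≺ρ , ρ≢τ with missing r≺ρ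
    ...   | z , m = ρ , allBut-∈τ r≺τ my r≺ρ
      (subst (Missing r ρ) (same-new-vertex r≺τ r₀≺τ r≢r₀ r≺ρ ρ≢τ r₀≺ρ₀ ρ₀≢τ m mw) m)

    allBut : ∀ {y} → T y → ∃ (AllBut y)
    allBut (inj₁ y∈τ)  = let r , r≺τ , m = ∃-opposite {τ = τ} dτ y∈τ in allBut-opposite r≺τ m
    allBut (inj₂ refl) = τ , allBut-w

    -- Along an edge `e` from `u` to `v`, let `z` be the vertex of `to ⟦ u ⟧` outside `to e`. The
    -- facet omitting `z` also contains `to e`, and since `e` has only two ends, this facet is dual
    -- to `v`.
    facet : ∀ u → ∃[ y ] T y × AllBut y (to ⟦ u ⟧)
    facet = vertex-induction K conn (λ u → ∃[ y ] T y × AllBut y (to ⟦ u ⟧)) step (w , inj₂ refl , allBut-w)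
      where
      step : ∀ {u v} → u ≢ v → ∀ e → ⟦ u ⟧ ≺ e → ⟦ v ⟧ ≺ e →
             ∃[ y ] T y × AllBut y (to ⟦ u ⟧) → ∃[ y ] T y × AllBut y (to ⟦ v ⟧)
      step {u} {v} u≢v e u≺e v≺e (y , Ty , A) with missing (anti u≺e)
      ... | z , m with allBut (⊆T A (∈τ m))
      ...   | ρ , B = z , ⊆T A (∈τ m) , subst (AllBut z) (conclude
        (edge-faces (dim-⟦⟧ {K = K} u) u≺e v≺e (u≢v ∘ ⟦⟧-injective {K = K}) (to≺⇒from≺ e≺ρ))) B
        where
        y∉e : y ∉ vertices (to e)
        y∉e = y∉ A ∘ ≺⇒⊆ (anti u≺e)
        y≢z : y ≢ z
        y≢z refl = y∉ A (∈τ m)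
        e≺ρ : to e ≺ ρ
        e≺ρ = ((λ q∈ → cover B (⊆T A (≺⇒⊆ (anti u≺e) q∈)) λ { refl → ∉σ m q∈ }) , y , cover B Ty y≢z , y∉e) ,
          trans (trans (dim≡ B) (sym (dim≡ A))) (≺-dim (anti u≺e))
        conclude : from ρ ≡ ⟦ u ⟧ ⊎ from ρ ≡ ⟦ v ⟧ → ρ ≡ to ⟦ v ⟧
        conclude (inj₂ eq) = trans (sym (to∘from ρ)) (cong to eq)
        conclude (inj₁ eq) = contradiction (subst (λ σ → z ∈ vertices σ)
          (trans (cong to (sym eq)) (to∘from ρ)) (∈τ m)) (y∉ B)

    T-full : ∀ z → T z
    T-full z = let u , z⊆u = covered ⟦ z ⟧ in ⊆T (proj₂ (proj₂ (facet u))) (z⊆u (x∈⁅x⁆ z))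

    face⇔ : ∀ p → Face L p ⇔ (Nonempty p × ∃[ y ] y ∉ p)
    face⇔ p = mk⇔
      (λ face-p → let u , p⊆u = covered (simplex p face-p) ; y , _ , A = facet u in
        SimplicialComplex.nonempty L face-p , y , y∉ A ∘ p⊆u)
      (λ (ne , y , y∉p) → let ρ , A = allBut (T-full y) in
        down-closed L (face L ρ) (λ {z} z∈p → cover A (T-full z) λ { refl → y∉p z∈p }) ne)

    -- A dual facet is determined by the vertex it omits. The reverse inequality comes from the same
    -- construction for the inverse of `F`.
    #vertices-≤ : #vertices K ℕ.≤ #vertices L
    #vertices-≤ = Finₚ.injective⇒≤ {f = proj₁ ∘ facet} λ {u} {v} eq → ⟦⟧-injective {K = K} (to-injective
      (allBut-unique (proj₂ (proj₂ (facet u))) (subst (λ y → AllBut y (to ⟦ v ⟧)) (sym eq) (proj₂ (proj₂ (facet v))))))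

  boundary-along : ∀ {r₀} → r₀ ≺ τ →
    (∀ p → Face L p ⇔ (Nonempty p × ∃[ y ] y ∉ p)) × #vertices K ℕ.≤ #vertices L
  boundary-along r₀≺τ with across r₀≺τ
  ... | ρ₀ , r₀≺ρ₀ , ρ₀≢τ with missing r₀≺ρ₀
  ...   | w , mw = face⇔ , #vertices-≤
    where open Facets r₀≺τ r₀≺ρ₀ ρ₀≢τ mw

  boundary : (∀ p → Face L p ⇔ (Nonempty p × ∃[ y ] y ∉ p)) × #vertices K ℕ.≤ #vertices L
  boundary = boundary-along (proj₂ (∃-face {τ = τ} dτ))

module _ {K : SimplicialComplex k} {L : SimplicialComplex ℓ} (Q : ∀ {n} → Subset n → Set)
         (Q-image : ∀ {m n} (φ : Fin n ↔ Fin m) p → Q p ⇔ Q (image φ p)) where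

  -- As `Q` is invariant under relabelling, any bijection of the vertices serves. Applied to
  -- boundaries of simplices and to single points.
  characterised⇒≅ : #vertices K ≡ #vertices L → (∀ p → Face K p ⇔ Q p) → (∀ p → Face L p ⇔ Q p) → K ≅ L
  characterised⇒≅ eq faceK faceL = record
    { vertices↔ = φ
    ; face⇔ = λ p → mk⇔
        (Equivalence.from (faceL (image φ p)) ∘ Equivalence.to (Q-image φ p) ∘ Equivalence.to (faceK p))
        (Equivalence.from (faceK p) ∘ Equivalence.from (Q-image φ p) ∘ Equivalence.to (faceL (image φ p)))
    }
    where
    φ : Fin (#vertices K) ↔ Fin (#vertices L)
    φ = subst (λ m → Fin (#vertices K) ↔ Fin m) eq (mk↔ₛ′ (λ i → i) (λ i → i) (λ _ → refl) (λ _ → refl))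

image-nonempty : ∀ {m n} (φ : Fin n ↔ Fin m) p → Nonempty p ⇔ Nonempty (image φ p)
image-nonempty φ p = mk⇔
  (λ (i , i∈) → Inverse.to φ i , ∈-image⁺ φ (subst (_∈ p) (sym (Inverse.strictlyInverseʳ φ i)) i∈))
  (λ (j , j∈) → Inverse.from φ j , ∈-image⁻ φ j∈)

image-proper : ∀ {m n} (φ : Fin n ↔ Fin m) p → (∃[ y ] y ∉ p) ⇔ (∃[ y ] y ∉ image φ p)
image-proper φ p = mk⇔
  (λ (i , i∉) → Inverse.to φ i , λ j∈ → i∉ (subst (_∈ p) (Inverse.strictlyInverseʳ φ i) (∈-image⁻ φ j∈)))
  (λ (j , j∉) → Inverse.from φ j , λ i∈ → j∉ (∈-image⁺ φ i∈))

-- Finite counting and the cyclic order of a 2-regular graph.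

injective⇒surjective : ∀ {m n} (f : Fin m → Fin n) → (∀ {i j} → f i ≡ f j → i ≡ j) → n ℕ.≤ m →
                       ∀ j → ∃[ i ] f i ≡ j
injective⇒surjective {m} {suc n} f inj n<m j = decidable-stable (Finₚ.any? λ i → f i Finₚ.≟ j) λ ∄ →
  let j≢f = λ i eq → ∄ (i , sym eq) in
  ℕₚ.<-irrefl refl (ℕₚ.≤-trans n<m (Finₚ.injective⇒≤ {f = λ i → punchOut (j≢f i)}
    λ {i} {i′} eq → inj (Finₚ.punchOut-injective (j≢f i) (j≢f i′) eq)))

least : ∀ {p} {P : ℕ → Set p} → (∀ i → Dec (P i)) → ∀ m → P m → ∃[ i ] P i × (∀ j → j ℕ.< i → ¬ P j)
least {P = P} P? m Pm = go m 0 (λ _ ()) (subst P (sym (ℕₚ.+-identityʳ m)) Pm)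
  where
  go : ∀ d i → (∀ j → j ℕ.< i → ¬ P j) → P (d ℕ.+ i) → ∃[ i ] P i × (∀ j → j ℕ.< i → ¬ P j)
  go zero    i below Pi = i , Pi , below
  go (suc d) i below Pd with P? i
  ... | yes Pi = i , Pi , below
  ... | no ¬Pi = go d (suc i) below′ (subst P (sym (ℕₚ.+-suc d i)) Pd)
    where
    below′ : ∀ j → j ℕ.< suc i → ¬ P j
    below′ j (s≤s j≤i) with ℕₚ.m≤n⇒m<n∨m≡n j≤i
    ... | inj₁ j<i  = below j j<i
    ... | inj₂ refl = ¬Pi

-- A connected 2-regular graph is a cycle: following the edges without
-- backtracking, the first vertex to be repeated is the initial one.
module CyclicOrder {n} {ℓ} (N : Fin n → Fin n → Set ℓ)
  (N-sym    : ∀ {u v} → N u v → N v u)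
  (N-irrefl : ∀ {u v} → N u v → u ≢ v)
  (onward   : ∀ {u v} → N u v → ∃[ w ] N v w × w ≢ u)
  (degree≤2 : ∀ {x a b c} → N x a → N x b → a ≢ b → N x c → c ≡ a ⊎ c ≡ b)
  (induct   : ∀ (P : Fin n → Set ℓ) → (∀ {u v} → N u v → P u → P v) → ∀ {u} → P u → ∀ v → P v)
  {u₀ v₀} (u₀v₀ : N u₀ v₀) where

  private
    walk : ℕ → ∃[ u ] ∃[ v ] N u v
    walk zero    = u₀ , v₀ , u₀v₀
    walk (suc i) = let u , v , uv = walk i ; w , vw , _ = onward uv in v , w , vw

    w : ℕ → Fin n
    w i = proj₁ (walk i)

    w-N : ∀ i → N (w i) (w (suc i))
    w-N i = proj₂ (proj₂ (walk i))

    w-onward : ∀ i → w (2 ℕ.+ i) ≢ w i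
    w-onward i = proj₂ (proj₂ (onward (w-N i)))

    Repeats : ℕ → Set
    Repeats j = ∃[ i ] w (toℕ {j} i) ≡ w j

    some-repeat : ∃ Repeats
    some-repeat with Finₚ.pigeonhole (ℕₚ.n<1+n n) (w ∘ toℕ)
    ... | i , j , i<j , eq = toℕ j , fromℕ< i<j , trans (cong w (Finₚ.toℕ-fromℕ< i<j)) eq

    first-repeat : ∃[ p ] Repeats p × (∀ j → j ℕ.< p → ¬ Repeats j)
    first-repeat = least (λ j → Finₚ.any? λ i → w (toℕ i) Finₚ.≟ w j) (proj₁ some-repeat) (proj₂ some-repeat)

  module Closed {p} (rep : Repeats p) (new : ∀ j → j ℕ.< p → ¬ Repeats j) where

    w-≢ : ∀ {i j} → i ℕ.< j → j ℕ.< p → w i ≢ w j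
    w-≢ i<j j<p eq = new _ j<p (fromℕ< i<j , trans (cong w (Finₚ.toℕ-fromℕ< i<j)) eq)

    w-injective : ∀ {i j} → i ℕ.< p → j ℕ.< p → w i ≡ w j → i ≡ j
    w-injective {i} {j} i<p j<p eq with ℕₚ.<-cmp i j
    ... | tri< i<j _ _ = contradiction eq (w-≢ i<j j<p)
    ... | tri≈ _ i≡j _ = i≡j
    ... | tri> _ _ j<i = contradiction (sym eq) (w-≢ j<i i<p)

    2<p : 2 ℕ.< p
    2<p = go p rep
      where
      go : ∀ p → Repeats p → 2 ℕ.< p
      go (suc zero)             (zero , eq)     = contradiction eq (N-irrefl (w-N 0))
      go (suc (suc zero))       (zero , eq)     = contradiction (sym eq) (w-onward 0)
      go (suc (suc zero))       (suc zero , eq) = contradiction eq (N-irrefl (w-N 1))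
      go (suc (suc (suc p)))    _               = s≤s (s≤s (s≤s z≤n))

    -- A return to `w (suc i)` makes `w p′` one of its two neighbours `w i` and `w (2 + i)`. That
    -- repeats a value before `p`, unless the positions are so close that there is a loop or a step
    -- back.
    closes : ∀ i p′ → p ≡ suc p′ → i ℕ.< p → w i ≡ w p → w p ≡ w 0
    closes zero    p′ eq i<p wi≡wp = sym wi≡wp
    closes (suc i) p′ refl i<p wi≡wp with degree≤2 (N-sym (w-N i)) (w-N (suc i)) (≢-sym (w-onward i))
      (subst (λ v → N v (w p′)) (sym wi≡wp) (N-sym (w-N p′)))
    ... | inj₁ eq = contradiction (sym eq) (w-≢ (ℕₚ.≤-pred i<p) (ℕₚ.n<1+n p′))
    ... | inj₂ eq with ℕₚ.m≤n⇒m<n∨m≡n (ℕₚ.≤-pred i<p)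
    ...   | inj₂ refl = contradiction wi≡wp (N-irrefl (w-N (suc i)))
    ...   | inj₁ i<p′ with ℕₚ.m≤n⇒m<n∨m≡n i<p′
    ...     | inj₁ i<p″ = contradiction (sym eq) (w-≢ i<p″ (ℕₚ.n<1+n p′))
    ...     | inj₂ refl = contradiction (sym wi≡wp) (w-onward (suc i))

    p≡ : p ≡ suc (ℕ.pred p)
    p≡ = sym (ℕₚ.suc-pred p {{ℕ.>-nonZero (ℕₚ.≤-trans (s≤s z≤n) 2<p)}})

    p⁻<p : ℕ.pred p ℕ.< p
    p⁻<p = ℕₚ.≤-reflexive (sym p≡)

    w-p : w p ≡ w 0
    w-p = let i , eq = rep in closes (toℕ i) (ℕ.pred p) p≡ (Finₚ.toℕ<n i) eq

    On : Fin n → Set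
    On v = ∃[ i ] i ℕ.< p × w i ≡ v

    on-suc : ∀ {i} → i ℕ.< p → On (w (suc i))
    on-suc {i} i<p with ℕₚ.m≤n⇒m<n∨m≡n i<p
    ... | inj₁ si<p = suc i , si<p , refl
    ... | inj₂ refl = 0 , ℕₚ.≤-trans (s≤s z≤n) 2<p , sym w-p

    1<p⁻ : 1 ℕ.< ℕ.pred p
    1<p⁻ = ℕₚ.≤-pred (subst (2 ℕ.<_) p≡ 2<p)

    on-step : ∀ {u v} → N u v → On u → On v
    on-step {v = v} uv (suc i , i<p , refl) with degree≤2 (N-sym (w-N i)) (w-N (suc i)) (≢-sym (w-onward i)) uv
    ... | inj₁ refl = i , ℕₚ.<-trans (ℕₚ.n<1+n i) i<p , refl
    ... | inj₂ refl = on-suc i<p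
    -- The start has no predecessor in the walk; closing up supplies the last vertex before `p`.
    on-step {v = v} uv (zero , 0<p , refl) with degree≤2 N₋ (w-N 0) (≢-sym (w-≢ 1<p⁻ p⁻<p)) uv
      where
      N₋ : N (w 0) (w (ℕ.pred p))
      N₋ = subst (λ x → N x (w (ℕ.pred p))) (trans (cong w (sym p≡)) w-p) (N-sym (w-N (ℕ.pred p)))
    ... | inj₁ refl = ℕ.pred p , p⁻<p , refl
    ... | inj₂ refl = on-suc 0<p

    on : ∀ v → On v
    on v = Lift.lower (induct (λ v → Lift ℓ (On v)) (λ uv (lift u) → lift (on-step uv u))
      (lift (0 , ℕₚ.≤-trans (s≤s z≤n) 2<p , refl)) v)

    succ : Fin n → Fin n
    succ v = w (suc (proj₁ (on v)))

    succ-N : ∀ v → N v (succ v)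
    succ-N v = let i , _ , eq = on v in subst (λ u → N u (succ v)) eq (w-N i)

    -- The walk never turns back, and at the last position two steps lead to `w 1`, which differs
    -- from the last vertex because `p` is at least 3.
    succ² : ∀ v → succ (succ v) ≢ v
    succ² v = go (on v) refl (on (succ v)) refl
      where
      -- Positions come with equations to `on`, so that they can be matched while `succ` stays tied
      -- to the chosen ones.
      go : ∀ (iv : On v) → iv ≡ on v → (jv : On (succ v)) → jv ≡ on (succ v) → succ (succ v) ≢ v
      go (i , i<p , refl) eqi (j , j<p , wj≡) eqj sss with ℕₚ.m≤n⇒m<n∨m≡n i<p
      ... | inj₁ si<p = w-onward i (trans (cong (w ∘ suc) (sym j≡)) (trans (cong (w ∘ suc ∘ proj₁) eqj) sss))
        where
        j≡ : j ≡ suc i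
        j≡ = w-injective j<p si<p (trans wj≡ (cong (w ∘ suc ∘ proj₁) (sym eqi)))
      ... | inj₂ si≡p = w-≢ (ℕₚ.≤-pred (subst (2 ℕ.<_) (sym si≡p) 2<p)) i<p
        (trans (cong (w ∘ suc) (sym j≡)) (trans (cong (w ∘ suc ∘ proj₁) eqj) sss))
        where
        j≡ : j ≡ 0
        j≡ = w-injective j<p (ℕₚ.≤-trans (s≤s z≤n) 2<p)
          (trans wj≡ (trans (cong (w ∘ suc ∘ proj₁) (sym eqi)) (trans (cong w si≡p) w-p)))

  orientation-of-cycle : ∃[ s ] (∀ v → N v (s v)) × (∀ v → s (s v) ≢ v)
  orientation-of-cycle with first-repeat
  ... | p , rep , new = succ , succ-N , succ²
    where open Closed rep new

-- Order-reversing isomorphisms: cycles.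

image-injective : ∀ {m n} (φ : Fin n ↔ Fin m) {p q} → image φ p ≡ image φ q → p ≡ q
image-injective φ eq = ⊆-antisym (half eq) (half (sym eq))
  where
  open Inverse φ
  half : ∀ {p q} → image φ p ≡ image φ q → p ⊆ q
  half {p} {q} eq {i} i∈ = subst (_∈ q) (strictlyInverseʳ i)
    (∈-image⁻ φ (subst (to i ∈_) eq (∈-image⁺ φ (subst (_∈ p) (sym (strictlyInverseʳ i)) i∈))))

module _ {K : SimplicialComplex k} where

  pair-adjacent : ∀ (σ : Simplex K) {u v} → u ∈ vertices σ → v ∈ vertices σ → Adjacent K u v
  pair-adjacent σ {u} {v} u∈ v∈ = down-closed K (face K σ)
    (λ x∈ → case ∈-pair⁻ x∈ of λ { (inj₁ refl) → u∈ ; (inj₂ refl) → v∈ }) (u , ∈-pairˡ u v)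

  ⟦⟧≺⇒∈ : ∀ {v} {σ : Simplex K} → ⟦ v ⟧ ≺ σ → v ∈ vertices σ
  ⟦⟧≺⇒∈ {v} v≺σ = ≺⇒⊆ v≺σ (x∈⁅x⁆ v)

  AtMost1 : Set k
  AtMost1 = ∀ {d} (σ : Simplex K) → dim σ ≢ suc (suc d)

  -- Allowing `u` and `v` to coincide treats points and edges alike, so that adjacency decides all
  -- faces.
  two-vertices : AtMost1 → ∀ σ → ∃[ u ] ∃[ v ] vertices σ ≡ ⁅ u ⁆ ∪ ⁅ v ⁆
  two-vertices low σ = go (dim σ) refl
    where
    go : ∀ d → dim σ ≡ d → ∃[ u ] ∃[ v ] vertices σ ≡ ⁅ u ⁆ ∪ ⁅ v ⁆
    go (suc (suc d)) dσ = contradiction dσ (low σ)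
    go zero dσ with dim≡0⇒∃ σ dσ
    ... | v , refl = v , v , ⊆-antisym (x∈p∪q⁺ ∘ inj₁) λ x∈ → [ (λ i → i) , (λ i → i) ]′ (x∈p∪q⁻ _ _ x∈)
    go (suc zero) dσ with ∃-face {τ = σ} dσ
    ... | ρ , ρ≺σ with dim≡0⇒∃ ρ (ℕₚ.suc-injective (trans (sym (≺-dim ρ≺σ)) dσ)) | missing ρ≺σ
    ...   | u , refl | v , m = u , v , ⊆-antisym left right
      where
      left : vertices σ ⊆ ⁅ u ⁆ ∪ ⁅ v ⁆
      left {x} x∈ with x Finₚ.≟ v
      ... | yes refl = ∈-pairʳ u v
      ... | no  x≢v  = x∈p∪q⁺ (inj₁ (cover m x∈ x≢v))
      right : ⁅ u ⁆ ∪ ⁅ v ⁆ ⊆ vertices σ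
      right x∈ with ∈-pair⁻ x∈
      ... | inj₁ refl = ⟦⟧≺⇒∈ ρ≺σ
      ... | inj₂ refl = ∈τ m

module CycleCase {K : SimplicialComplex k} {L : SimplicialComplex ℓ} (conn : ∀ u v → Star (Adjacent K) u v)
                 (F : HasseIso K L) (anti : ∀ {σ τ} → σ ≺ τ → HasseIso.to F τ ≺ HasseIso.to F σ)
                 {v₀ : Fin (#vertices K)} {e₀ : Simplex K} (v₀≺e₀ : ⟦ v₀ ⟧ ≺ e₀)
                 (dim-v₀ : dim (HasseIso.to F ⟦ v₀ ⟧) ≡ 1) where
  open HasseIso F
  open OrderReversing F anti

  dim-dual : ∀ u → dim (to ⟦ u ⟧) ≡ 1
  dim-dual = vertex-induction K conn (λ u → dim (to ⟦ u ⟧) ≡ 1)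
    (λ _ e u≺e v≺e du → trans (≺-dim (anti v≺e)) (trans (sym (≺-dim (anti u≺e))) du)) dim-v₀

  dim-edge : ∀ {u} {e : Simplex K} → ⟦ u ⟧ ≺ e → dim (to e) ≡ 0
  dim-edge {u} u≺e = ℕₚ.suc-injective (trans (sym (≺-dim (anti u≺e))) (dim-dual u))

  lowK : AtMost1 {K = K}
  lowK {d} σ dσ with low-flag d {σ} dσ
  ... | v , a , b , v≺a , a≺b = case trans (sym (dim-edge v≺a)) (≺-dim (anti a≺b)) of λ ()

  lowL : AtMost1 {K = L}
  lowL {d} σ dσ with low-flag d {σ} dσ
  ... | w , a , b , w≺a , a≺b =
    lowK (from ⟦ w ⟧) (trans (≺-dim (from-anti w≺a)) (cong suc (≺-dim (from-anti a≺b))))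

  -- The edges at `x` are dual to the ends of the edge `to ⟦ x ⟧`.
  edges≤2 : ∀ {x} {e e′ e″ : Simplex K} → ⟦ x ⟧ ≺ e → ⟦ x ⟧ ≺ e′ → e ≢ e′ → ⟦ x ⟧ ≺ e″ → e″ ≡ e ⊎ e″ ≡ e′
  edges≤2 i i′ e≢e′ i″ with edge-faces (dim-edge i) (anti i) (anti i′) (e≢e′ ∘ to-injective) (anti i″)
  ... | inj₁ eq = inj₁ (to-injective eq)
  ... | inj₂ eq = inj₂ (to-injective eq)

  ends : ∀ {u v x} {e : Simplex K} → ⟦ u ⟧ ≺ e → ⟦ v ⟧ ≺ e → u ≢ v → ⟦ x ⟧ ≺ e → x ≡ u ⊎ x ≡ v
  ends {u} i j u≢v l with edge-faces (dim-⟦⟧ {K = K} u) i j (u≢v ∘ ⟦⟧-injective {K = K}) l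
  ... | inj₁ eq = inj₁ (⟦⟧-injective {K = K} eq)
  ... | inj₂ eq = inj₂ (⟦⟧-injective {K = K} eq)

  same-edge : ∀ {u v} {e e′ : Simplex K} → u ≢ v → ⟦ u ⟧ ≺ e → ⟦ v ⟧ ≺ e → ⟦ u ⟧ ≺ e′ → ⟦ v ⟧ ≺ e′ → e ≡ e′
  same-edge u≢v i j i′ j′ = coface-determined i j (u≢v ∘ ⟦⟧-injective {K = K}) i′ j′

  N : Fin (#vertices K) → Fin (#vertices K) → Set k
  N u v = Σ (Simplex K) λ e → ⟦ u ⟧ ≺ e × ⟦ v ⟧ ≺ e × u ≢ v

  far-end : ∀ {v} {e : Simplex K} → ⟦ v ⟧ ≺ e → ∃[ w ] ⟦ w ⟧ ≺ e × w ≢ v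
  far-end {v} v≺e with another-face v≺e
  ... | ρ , ρ≺e , ρ≢v with dim≡0⇒∃ ρ (trans (ℕₚ.suc-injective (trans (sym (≺-dim ρ≺e)) (≺-dim v≺e))) (dim-⟦⟧ {K = K} v))
  ...   | w , refl = w , ρ≺e , λ { refl → ρ≢v refl }

  -- The other end of `to ⟦ v ⟧` is dual to the second edge at `v`. Its far end is not `u`, since a
  -- complex has no two edges with the same ends.
  onward : ∀ {u v} → N u v → ∃[ w ] N v w × w ≢ u
  onward {u} {v} (e , u≺e , v≺e , u≢v) with another-face (anti v≺e)
  ... | ρ , ρ≺ , ρ≢ with far-end (≺to⇒≺from ρ≺)
  ...   | w , w≺ , w≢v = w , (from ρ , ≺to⇒≺from ρ≺ , w≺ , ≢-sym w≢v) , λ { refl →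
    ρ≢ (trans (sym (to∘from ρ)) (cong to (same-edge u≢v w≺ (≺to⇒≺from ρ≺) u≺e v≺e))) }

  degree≤2 : ∀ {x a b c} → N x a → N x b → a ≢ b → N x c → c ≡ a ⊎ c ≡ b
  degree≤2 {x} {a} {b} {c} (e , i , j , x≢a) (e′ , i′ , j′ , x≢b) a≢b (e″ , i″ , j″ , x≢c)
    with edges≤2 i i′ e≢e′ i″
    where
    e≢e′ : e ≢ e′
    e≢e′ refl with ends i j x≢a j′
    ... | inj₁ b≡x = x≢b (sym b≡x)
    ... | inj₂ b≡a = a≢b (sym b≡a)
  ... | inj₁ refl = inj₁ ([ (λ c≡x → contradiction (sym c≡x) x≢c) , (λ eq → eq) ]′ (ends i j x≢a j″))
  ... | inj₂ refl = inj₂ ([ (λ c≡x → contradiction (sym c≡x) x≢c) , (λ eq → eq) ]′ (ends i′ j′ x≢b j″))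

  module Oriented (s : Fin (#vertices K) → Fin (#vertices K)) (s-N : ∀ v → N v (s v))
                  (s² : ∀ v → s (s v) ≢ v) where

    o : Fin (#vertices K) → Simplex K
    o v = proj₁ (s-N v)

    v≺o : ∀ v → ⟦ v ⟧ ≺ o v
    v≺o v = proj₁ (proj₂ (s-N v))

    sv≺o : ∀ v → ⟦ s v ⟧ ≺ o v
    sv≺o v = proj₁ (proj₂ (proj₂ (s-N v)))

    v≢sv : ∀ v → v ≢ s v
    v≢sv v = proj₂ (proj₂ (proj₂ (s-N v)))

    ends-o : ∀ {x} v → ⟦ x ⟧ ≺ o v → x ≡ v ⊎ x ≡ s v
    ends-o v = ends (v≺o v) (sv≺o v) (v≢sv v)

    -- Otherwise `u` and `v` would be successors of each other, against `s²`.
    o-injective : ∀ {u v} → o u ≡ o v → u ≡ v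
    o-injective {u} {v} eq with ends-o v (subst (⟦ u ⟧ ≺_) eq (v≺o u)) | ends-o u (subst (⟦ v ⟧ ≺_) (sym eq) (v≺o v))
    ... | inj₁ u≡v  | _          = u≡v
    ... | inj₂ _    | inj₁ v≡u   = sym v≡u
    ... | inj₂ u≡sv | inj₂ v≡su  = contradiction (trans (cong s (sym u≡sv)) (sym v≡su)) (s² v)

    -- Otherwise `o u` and `o v` would be both edges at `s u`, leaving none to be `o (s u)`.
    s-injective : ∀ {u v} → s u ≡ s v → u ≡ v
    s-injective {u} {v} eq = decidable-stable (u Finₚ.≟ v) λ u≢v →
      case edges≤2 (sv≺o u) (subst (λ x → ⟦ x ⟧ ≺ o v) (sym eq) (sv≺o v)) (u≢v ∘ o-injective) (v≺o (s u)) of λ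
      { (inj₁ o≡) → v≢sv u (sym (o-injective o≡))
      ; (inj₂ o≡) → v≢sv v (trans (sym (o-injective o≡)) eq) }

    s-surjective : ∀ v → ∃[ u ] s u ≡ v
    s-surjective = injective⇒surjective s s-injective ℕₚ.≤-refl

    edge-is-o : ∀ {x} {e : Simplex K} → ⟦ x ⟧ ≺ e → e ≡ o x ⊎ (∃[ u ] s u ≡ x × e ≡ o u)
    edge-is-o {x} x≺e with s-surjective x
    ... | u , refl with edges≤2 (v≺o (s u)) (sv≺o u) (λ eq → v≢sv u (sym (o-injective eq))) x≺e
    ...   | inj₁ eq = inj₁ eq
    ...   | inj₂ eq = inj₂ (u , refl , eq)

    -- The half-step: a vertex moves to the edge leaving it, which `F` takes to a vertex of `L`.
    module Dual (ψ : Fin (#vertices K) → Fin (#vertices L)) (ψ-dual : ∀ v → to (o v) ≡ ⟦ ψ v ⟧) where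

      ψ-≺ : ∀ {v x} → ⟦ x ⟧ ≺ o v → ψ v ∈ vertices (to ⟦ x ⟧)
      ψ-≺ {v} {x} x≺o = ⟦⟧≺⇒∈ (subst (_≺ to ⟦ x ⟧) (ψ-dual v) (anti x≺o))

      ψ-injective : ∀ {u v} → ψ u ≡ ψ v → u ≡ v
      ψ-injective {u} {v} eq = o-injective (to-injective
        (trans (ψ-dual u) (trans (cong ⟦_⟧ eq) (sym (ψ-dual v)))))

      ψ-surjective : ∀ w → ∃[ v ] ψ v ≡ w
      ψ-surjective w = go (dim σ) refl
        where
        σ : Simplex K
        σ = from ⟦ w ⟧
        hit : ∀ {v} → σ ≡ o v → ∃[ v ] ψ v ≡ w
        hit {v} eq = v , ⟦⟧-injective {K = L} (trans (sym (ψ-dual v)) (trans (cong to (sym eq)) (to∘from ⟦ w ⟧)))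
        go : ∀ d → dim σ ≡ d → ∃[ v ] ψ v ≡ w
        go zero dσ with dim≡0⇒∃ σ dσ
        ... | v , eq = case trans (sym (dim-⟦⟧ {K = L} w))
          (trans (cong dim (trans (sym (to∘from ⟦ w ⟧)) (cong to eq))) (dim-dual v)) of λ ()
        go (suc d) dσ with ∃-face {τ = σ} dσ
        ... | ρ , ρ≺σ with low-or-0 d dσ
          where
          low-or-0 : ∀ d → dim σ ≡ suc d → d ≡ 0
          low-or-0 zero    _  = refl
          low-or-0 (suc d) dσ = contradiction dσ (lowK σ)
        ...   | refl with dim≡0⇒∃ ρ (ℕₚ.suc-injective (trans (sym (≺-dim ρ≺σ)) dσ))
        ...     | x , refl with edge-is-o ρ≺σ
        ...       | inj₁ eq           = hit eq
        ...       | inj₂ (u , _ , eq) = hit eq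

      φ : Fin (#vertices K) ↔ Fin (#vertices L)
      φ = mk↔ₛ′ ψ (proj₁ ∘ ψ-surjective) (proj₂ ∘ ψ-surjective)
        (λ v → ψ-injective (proj₂ (ψ-surjective (ψ v))))

      -- For neighbours the edges `o u` and `o v` share an end, and the dual of that end is an edge
      -- through `ψ u` and `ψ v`. `common-coface` is the converse reading.
      ψ-adjacent : ∀ u v → Adjacent K u v → Adjacent L (ψ u) (ψ v)
      ψ-adjacent u v uv with u Finₚ.≟ v
      ... | yes refl = pair-adjacent {K = L} ⟦ ψ u ⟧ (x∈⁅x⁆ (ψ u)) (x∈⁅x⁆ (ψ u))
      ... | no u≢v with edge-is-o (≺-pairˡ K uv u≢v)
      ...   | inj₁ eq = pair-adjacent (to ⟦ v ⟧) (ψ-≺ (subst (⟦ v ⟧ ≺_) eq (≺-pairʳ K uv u≢v))) (ψ-≺ (v≺o v))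
      ...   | inj₂ (c , sc≡u , eq) with ends-o c (subst (⟦ v ⟧ ≺_) eq (≺-pairʳ K uv u≢v))
      ...     | inj₁ refl = pair-adjacent (to ⟦ u ⟧) (ψ-≺ (v≺o u)) (ψ-≺ (subst (λ x → ⟦ x ⟧ ≺ o c) sc≡u (sv≺o c)))
      ...     | inj₂ v≡sc = contradiction (trans (sym sc≡u) (sym v≡sc)) u≢v

      dual-≺ : ∀ {u} {q : Simplex L} → ⟦ ψ u ⟧ ≺ q → from q ≺ o u
      dual-≺ {u} {q} ψu≺q = to≺⇒from≺ (subst (_≺ q) (sym (ψ-dual u)) ψu≺q)

      common-end : ∀ {u v x} → u ≢ v → ⟦ x ⟧ ≺ o u → ⟦ x ⟧ ≺ o v → Adjacent K u v
      common-end {u} {v} u≢v x≺u x≺v with ends-o u x≺u | ends-o v x≺v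
      ... | inj₁ refl | inj₁ u≡v   = contradiction u≡v u≢v
      ... | inj₁ refl | inj₂ refl  = pair-adjacent (o v) (⟦⟧≺⇒∈ (sv≺o v)) (⟦⟧≺⇒∈ (v≺o v))
      ... | inj₂ refl | inj₁ refl  = pair-adjacent (o u) (⟦⟧≺⇒∈ (v≺o u)) (⟦⟧≺⇒∈ (sv≺o u))
      ... | inj₂ refl | inj₂ su≡sv = contradiction (s-injective su≡sv) u≢v

      common-coface : ∀ {u v} {q : Simplex L} → u ≢ v → ⟦ ψ u ⟧ ≺ q → ⟦ ψ v ⟧ ≺ q → Adjacent K u v
      common-coface {u} {v} {q} u≢v ψu≺q ψv≺q with dim≡0⇒∃ (from q) dq
        where
        dq : dim (from q) ≡ 0
        dq = ℕₚ.suc-injective (trans (sym (≺-dim (dual-≺ ψu≺q)))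
          (trans (≺-dim (v≺o u)) (cong suc (dim-⟦⟧ {K = K} u))))
      ... | x , eq = common-end u≢v (subst (_≺ o u) eq (dual-≺ ψu≺q)) (subst (_≺ o v) eq (dual-≺ ψv≺q))

      ψ-adjacent⁻ : ∀ u v → Adjacent L (ψ u) (ψ v) → Adjacent K u v
      ψ-adjacent⁻ u v ψuv with u Finₚ.≟ v
      ... | yes refl = pair-adjacent {K = K} ⟦ u ⟧ (x∈⁅x⁆ u) (x∈⁅x⁆ u)
      ... | no u≢v = common-coface u≢v (≺-pairˡ L ψuv (u≢v ∘ ψ-injective)) (≺-pairʳ L ψuv (u≢v ∘ ψ-injective))

      dual⇒≅ : K ≅ L
      dual⇒≅ = record { vertices↔ = φ ; face⇔ = λ p → mk⇔ (fwd p) (bwd p) }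
        where
        fwd : ∀ p → Face K p → Face L (image φ p)
        fwd p face-p with two-vertices lowK (simplex p face-p)
        ... | u , v , refl = subst (Face L) (sym (image-pair φ u v)) (ψ-adjacent u v face-p)
        bwd : ∀ p → Face L (image φ p) → Face K p
        bwd p face-q with two-vertices lowL (simplex (image φ p) face-q)
        ... | u′ , v′ , eq with ψ-surjective u′ | ψ-surjective v′
        ...   | u , refl | v , refl = subst (Face K) (sym (image-injective φ {p} (trans eq (sym (image-pair φ u v)))))
          (ψ-adjacent⁻ u v (subst (Face L) eq face-q))

    oriented⇒≅ : K ≅ L
    oriented⇒≅ = Dual.dual⇒≅ (proj₁ ∘ dual) (proj₂ ∘ dual)
      where
      dual : ∀ v → ∃[ w ] to (o v) ≡ ⟦ w ⟧
      dual v = dim≡0⇒∃ (to (o v)) (dim-edge (v≺o v))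

  cycle⇒≅ : K ≅ L
  cycle⇒≅ = let s , s-N , s² = orientation-of-cycle in Oriented.oriented⇒≅ s s-N s²
    where
    far = far-end v₀≺e₀
    open CyclicOrder N (λ (e , i , j , u≢v) → e , j , i , ≢-sym u≢v) (proj₂ ∘ proj₂ ∘ proj₂) onward degree≤2
      (λ P step → vertex-induction K conn P λ u≢v e u≺e v≺e → step (e , u≺e , v≺e , u≢v))
      (e₀ , v₀≺e₀ , proj₁ (proj₂ far) , ≢-sym (proj₂ (proj₂ far)))

-- Assembling the cases.

module _ {K : SimplicialComplex k} {L : SimplicialComplex ℓ} (connK : ∀ u v → Star (Adjacent K) u v)
         (connL : ∀ u v → Star (Adjacent L) u v) (F : HasseIso K L)
         (anti : ∀ {σ τ} → σ ≺ τ → HasseIso.to F τ ≺ HasseIso.to F σ) where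
  open HasseIso F
  open OrderReversing F anti

  orderReversing⇒≅ : ∀ {v e} → ⟦ v ⟧ ≺ e → K ≅ L
  orderReversing⇒≅ {v} {e} v≺e = go (dim (to e)) refl
    where
    go : ∀ d → dim (to e) ≡ d → K ≅ L
    go zero    eq = CycleCase.cycle⇒≅ connK F anti v≺e (trans (≺-dim (anti v≺e)) (cong suc eq))
    go (suc d) eq with low-flag d {to ⟦ v ⟧} (trans (≺-dim (anti v≺e)) (cong suc eq))
    -- Here the dual of `v` has dimension at least 2, and the flag in it makes the same true of the
    -- dual of `w`; so both complexes are boundaries.
    ... | w , a , b , w≺a , a≺b =
      let faceL , K≤L = Boundary.boundary connK F anti v (trans (≺-dim (anti v≺e)) (cong suc eq))
          faceK , L≤K = Boundary.boundary connL (hasseSym F) from-anti w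
            (trans (≺-dim (from-anti w≺a)) (cong suc (≺-dim (from-anti a≺b))))
      in characterised⇒≅ (λ p → Nonempty p × ∃[ y ] y ∉ p)
        (λ φ p → mk⇔
          (λ (ne , pr) → Equivalence.to (image-nonempty φ p) ne , Equivalence.to (image-proper φ p) pr)
          (λ (ne , pr) → Equivalence.from (image-nonempty φ p) ne , Equivalence.from (image-proper φ p) pr))
        (ℕₚ.≤-antisym K≤L L≤K) faceK faceL

module _ (K : SimplicialComplex k) (conn : ∀ u v → Star (Adjacent K) u v) where

  no-primitives⇒point : ¬ Fin (#primitives K) → ∀ (u v : Fin (#vertices K)) → u ≡ v
  no-primitives⇒point none u = vertex-induction K conn (u ≡_)
    (λ _ e u≺e _ → ⊥-elim (none (proj₁ (primitive-inc K u≺e)))) refl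

  point⇒face : (∀ (u v : Fin (#vertices K)) → u ≡ v) → ∀ p → Face K p ⇔ Nonempty p
  point⇒face u≡v p = mk⇔ (SimplicialComplex.nonempty K) λ (v , v∈p) →
    down-closed K (vertex K v) (λ {x} _ → subst (_∈ ⁅ v ⁆) (u≡v v x) (x∈⁅x⁆ v)) (v , v∈p)

  -- A vertex without coface would be invisible in the line graph. The first step of a chain from
  -- `v₀` to `upper K i` gives one coface; edges along paths give the others.
  primitive⇒cofaces : Fin (#primitives K) → ∀ v → Σ (Simplex K) (⟦ v ⟧ ≺_)
  primitive⇒cofaces i = vertex-induction K conn (λ v → Σ (Simplex K) (⟦ v ⟧ ≺_))
    (λ _ e _ v≺e _ → e , v≺e) {v₀} (first (⊆⇒≺* {σ = ⟦ v₀ ⟧} {upper K i} v₀⊆τ) λ eq →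
      dim≡0⇒minimal (trans (cong dim (sym eq)) (dim-⟦⟧ {K = K} v₀)) (primitivePair-≺ K i))
    where
    v₀ = proj₁ (simplex-nonempty (Defs.lower K i))
    v₀∈ = proj₂ (simplex-nonempty (Defs.lower K i))
    v₀⊆τ : ⁅ v₀ ⁆ ⊆ vertices (upper K i)
    v₀⊆τ = ≺⇒⊆ (primitivePair-≺ K i) ∘ ∈⇒⟦⟧⊆ {K = K} v₀∈
    first : ∀ {τ : Simplex K} → Star _≺_ ⟦ v₀ ⟧ τ → ⟦ v₀ ⟧ ≢ τ → Σ (Simplex K) (⟦ v₀ ⟧ ≺_)
    first ε        v≢v = contradiction refl v≢v
    first (v≺e ◅ _) _  = _ , v≺e

fin-or-empty : ∀ n → Fin n ⊎ ¬ Fin n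
fin-or-empty zero    = inj₂ λ ()
fin-or-empty (suc n) = inj₁ zero

module _ {K : SimplicialComplex k} {L : SimplicialComplex ℓ}
         (connK : ∀ u v → Star (Adjacent K) u v) (connL : ∀ u v → Star (Adjacent L) u v) where

  points⇒≅ : Fin (#vertices K) → Fin (#vertices L) → ¬ Fin (#primitives K) → ¬ Fin (#primitives L) → K ≅ L
  points⇒≅ u v noneK noneL = characterised⇒≅ Nonempty image-nonempty
    (ℕₚ.≤-antisym (Finₚ.injective⇒≤ {f = λ _ → v} λ _ → pointK _ _) (Finₚ.injective⇒≤ {f = λ _ → u} λ _ → pointL _ _))
    (point⇒face K connK pointK) (point⇒face L connL pointL)
    where
    pointK : ∀ (u v : Fin (#vertices K)) → u ≡ v
    pointK = no-primitives⇒point K connK noneK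
    pointL : ∀ (u v : Fin (#vertices L)) → u ≡ v
    pointL = no-primitives⇒point L connL noneL

  hasseIso⇒≅ : HasseIso K L → ∀ {v e} → ⟦_⟧ {K = K} v ≺ e → K ≅ L
  hasseIso⇒≅ F v≺e with orientation connK F v≺e
  ... | inj₁ mono = orderPreserving⇒≅ F mono
  ... | inj₂ anti = orderReversing⇒≅ connK connL F anti v≺e

  lineIso⇒≅ : LineIso K L → Fin (#vertices K) → Fin (#primitives K) → K ≅ L
  lineIso⇒≅ I v e = hasseIso⇒≅ (lineIso⇒hasseIso I cofaceK cofaceL) (proj₂ (cofaceK v))
    where
    cofaceK : ∀ v → Σ (Simplex K) (⟦ v ⟧ ≺_)
    cofaceK = primitive⇒cofaces K connK e
    cofaceL : ∀ v → Σ (Simplex L) (⟦ v ⟧ ≺_)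
    cofaceL = primitive⇒cofaces L connL (LineIso.φ I e)

theoremA : ∀ {k ℓ} (K : SimplicialComplex k) (L : SimplicialComplex ℓ) →
    Connected K → Connected L → 𝔐 K ≅ 𝔐 L → K ≅ L
theoremA K L (u , connK) (v , connL) I =
  [ lineIso⇒≅ connK connL (≅⇒lineIso {K = K} {L} I) u
  -- With `𝔐 K` empty, `𝔐 L` is empty too, and both complexes are points.
  , (λ none → points⇒≅ connK connL u v none (none ∘ Inverse.from (_≅_.vertices↔ I)))
  ]′ (fin-or-empty (#primitives K))
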